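{- For every positive integer $n$, \[ \mathcal{M}^{(4)}(n)=\Bigl\lfloor \frac{n^2-28n+245}{216}\Bigr\rfloor-\begin{cases}1,&\text{if } n\bmod 108\in I,\\ 0,&\text{otherwise,}\end{cases} \] where $I=\{0,1,27,28,43,47,48,53,58,63,67,68,69,73,78,83,88,89,93\}$.
   Context: For $n\in\mathbb{N}$ let $[n]=\{1,\dots,n\}$. For $a>0$ and integers $1\le s\le t\le n$, consider the coloring of $[n]$ in which $1,\dots,s$ and $t+1,\dots,n$ are red and $s+1,\dots,t$ are blue (written $R^sB^{t-s}R^{n-t}$). Define $\mathcal{M}^{(a)}(n,s,t)$ as the number of ordered pairs $(x,y)\in[n]^2$ such that the triple $T=(x,y,x+\lfloor ay\rfloor)$ lies in $[n]^3$ and either $T\in([s]\cup\{t+1,\dots,n\})^3$ or $T\in\{s+1,\dots,t\}^3$. Define $\mathcal{M}^{(a)}(n)=\min_{1\le s\le t\le n}\mathcal{M}^{(a)}(n,s,t)$. -}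

module Defs where

import Data.Nat.Properties
open import Data.Nat using (ℕ; zero; suc; _+_; _*_; _∸_; _≤_; _<_; _≤ᵇ_; _<ᵇ_; _/_)
open import Data.Bool using (Bool; true; false; _∧_; _∨_; if_then_else_)
open import Data.Nat.ListAction using (sum)
open import Data.List using (List; map; applyUpTo; _∷_; [])
open import Data.Product using (Σ; _×_; _,_)

range : ℕ → List ℕ
range n = applyUpTo suc n

inN : ℕ → ℕ → Bool
inN n v = (1 ≤ᵇ v) ∧ (v ≤ᵇ n)

-- red part of the coloring R^s B^(t-s) R^(n-t): [s] ∪ {t+1,…,n}
isRed : ℕ → ℕ → ℕ → ℕ → Bool
isRed n s t v = ((1 ≤ᵇ v) ∧ (v ≤ᵇ s)) ∨ ((t <ᵇ v) ∧ (v ≤ᵇ n))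

isBlue : ℕ → ℕ → ℕ → Bool
isBlue s t v = (s <ᵇ v) ∧ (v ≤ᵇ t)

good : ℕ → ℕ → ℕ → ℕ → ℕ → Bool
good n s t x y =
  let z = x + 4 * y in
  inN n x ∧ inN n y ∧ inN n z ∧
  ((isRed n s t x ∧ isRed n s t y ∧ isRed n s t z) ∨
   (isBlue s t x ∧ isBlue s t y ∧ isBlue s t z))

count : Bool → ℕ
count true = 1
count false = 0

M4 : ℕ → ℕ → ℕ → ℕ
M4 n s t = sum (map (λ x → sum (map (λ y → count (good n s t x y)) (range n))) (range n))

I : List ℕ
I = 0 ∷ 1 ∷ 27 ∷ 28 ∷ 43 ∷ 47 ∷ 48 ∷ 53 ∷ 58 ∷ 63 ∷ 67 ∷ 68 ∷ 69 ∷ 73 ∷ 78 ∷ 83 ∷ 88 ∷ 89 ∷ 93 ∷ []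

import Data.Integer as ℤ
open ℤ using (ℤ; +_)
open import Data.Integer.DivMod using (_/ℕ_)
open import Data.List.Membership.DecPropositional (Data.Nat.Properties._≟_) using (_∈?_)
open import Relation.Binary.PropositionalEquality using (_≡_)
open import Data.Nat using (_%_)
open import Relation.Nullary.Decidable using (Dec; yes; no)

corr : ℕ → ℤ
corr n with (n % 108) ∈? I
... | yes _ = + 1
... | no _ = + 0

-- ⌊(n² − 28n + 245)/216⌋ − corr n   (in ℤ; /ℕ is floor (Euclidean) division by a positive ℕ)
rhs4 : ℕ → ℤ
rhs4 n = ((+ n ℤ.* + n ℤ.- + 28 ℤ.* + n) ℤ.+ + 245) /ℕ 216 ℤ.- corr n

IsM4min : ℕ → ℤ → Set
IsM4min n m =
  (Σ ℕ λ s → Σ ℕ λ t → (1 ≤ s) × (s ≤ t) × (t ≤ n) × (+ M4 n s t ≡ m))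
  × (∀ s t → 1 ≤ s → s ≤ t → t ≤ n → m ℤ.≤ + M4 n s t)

{-# OPTIONS --safe #-}

-- Write τ(m) for the number of pairs x, y ≥ 1 with x + 4y ≤ m, so that τ(m) = ⌊(m − 2)²/8⌋ for m ≥ 0.
-- When n − t ≤ 4s + 4 and neither 5s − t > s nor 5s > n, the count is at least
-- τ(s) + τ(t − 5s) + τ(n − t), where the quasi-polynomial τ is also used at negative arguments (there it
-- counts the red triples with x, y ≤ s and z > t, by the reflection τ(−d) = τ(4 + d)); equality holds
-- for 5s ≤ t with n ≤ 4t + 4.  Put a = s, b = t − 5s, c = n − t.  As 5a + b + c = n, Lagrange's identity gives
--   27 ((a−2)² + (b−2)² + (c−2)²) = (n−14)² + p² + (p−5q)² + q²,  p = a − 5b + 8,  q = c − b,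
-- so only finitely many (p, q) can compete, and both sides change by the same amount under
-- (a, b, c) ↦ (a + 20, b + 4, c + 4), n ↦ n + 108; this leaves a finite check.  In the remaining ranges
-- of (s, t), cruder quadratic lower bounds for the count suffice once n ≥ 29; for n ≤ 28 the minimum is 0.
module Submission where

open import Defs
open import Data.Bool using (Bool; true; false; T; _∧_)
open import Data.Bool.Properties using (T-≡; ∨-identityʳ; ∧-zeroʳ; ∧-idem)
open import Data.List using (map; applyUpTo)
open import Data.List.Membership.Propositional using (_∈_)
open import Data.Nat using (ℕ; zero; suc; _+_; _*_; _∸_; _/_; _%_; _⊓_; _⊔_; _≤_; _<_; z≤n; s≤s; _≤ᵇ_; _<ᵇ_; NonZero)
open import Data.Nat.DivMod using (m%n<n; m%n%n≡m%n; m≡m%n+[m/n]*n)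
open import Data.Nat.ListAction using (sum)
open import Data.Nat.Properties
open import Algebra.Properties.CommutativeSemigroup +-commutativeSemigroup using (interchange)
open import Data.List.Membership.DecPropositional (_≟_) using (_∈?_)
open import Data.Nat.Tactic.RingSolver using (solve-∀)
open import Data.Product using (Σ; ∃; _×_; _,_)
open import Data.Sum using (_⊎_; inj₁; inj₂)
open import Function using (_∘_)
open import Function.Bundles using (Equivalence)
open import Relation.Binary.PropositionalEquality
open import Relation.Nullary using (¬_; Dec; yes; no; contradiction)
open import Relation.Nullary.Decidable using (toWitness; _×-dec_; _→-dec_)

-- Counting row by row

-- Indices start at 1, as in `range`; recursion shifts the summand, so no list is carried along.
∑ : ℕ → (ℕ → ℕ) → ℕ
∑ zero    f = 0
∑ (suc n) f = f 1 + ∑ n (f ∘ suc)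

-- The generating function `g` is generalised because `applyUpTo` recurses by composing it with
-- `suc`.
sum-applyUpTo : ∀ (f g : ℕ → ℕ) n → sum (map f (applyUpTo (g ∘ suc) n)) ≡ ∑ n (f ∘ g)
sum-applyUpTo f g zero    = refl
sum-applyUpTo f g (suc n) = cong (f (g 1) +_) (sum-applyUpTo f (g ∘ suc) n)

∑-cong : ∀ n {f g : ℕ → ℕ} → (∀ i → i < n → f (suc i) ≡ g (suc i)) → ∑ n f ≡ ∑ n g
∑-cong zero    h = refl
∑-cong (suc n) h = cong₂ _+_ (h 0 (s≤s z≤n)) (∑-cong n λ i i<n → h (suc i) (s≤s i<n))

∑-mono : ∀ n {f g} → (∀ i → i < n → f (suc i) ≤ g (suc i)) → ∑ n f ≤ ∑ n g
∑-mono zero    h = z≤n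
∑-mono (suc n) h = +-mono-≤ (h 0 (s≤s z≤n)) (∑-mono n λ i i<n → h (suc i) (s≤s i<n))

∑-zero : ∀ n f → (∀ i → i < n → f (suc i) ≡ 0) → ∑ n f ≡ 0
∑-zero zero    f h = refl
∑-zero (suc n) f h = cong₂ _+_ (h 0 (s≤s z≤n)) (∑-zero n (f ∘ suc) λ i i<n → h (suc i) (s≤s i<n))

∑-distrib-+ : ∀ n f g → ∑ n (λ i → f i + g i) ≡ ∑ n f + ∑ n g
∑-distrib-+ zero    f g = refl
∑-distrib-+ (suc n) f g = trans
  (cong (f 1 + g 1 +_) (∑-distrib-+ n (f ∘ suc) (g ∘ suc)))
  (interchange (f 1) (g 1) (∑ n (f ∘ suc)) (∑ n (g ∘ suc)))

∑-split : ∀ m n f → ∑ (m + n) f ≡ ∑ m f + ∑ n (λ i → f (m + i))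
∑-split zero    n f = refl
∑-split (suc m) n f = trans (cong (f 1 +_) (∑-split m n (f ∘ suc)))
  (sym (+-assoc (f 1) _ _))

∑-last : ∀ n f → ∑ (suc n) f ≡ ∑ n f + f (suc n)
∑-last zero    f = +-comm (f 1) 0
∑-last (suc n) f = trans (cong (f 1 +_) (∑-last n (f ∘ suc))) (sym (+-assoc (f 1) _ _))

∑-swap : ∀ m n (f : ℕ → ℕ → ℕ) → ∑ m (λ i → ∑ n (f i)) ≡ ∑ n (λ j → ∑ m (λ i → f i j))
∑-swap zero    n f = sym (∑-zero n (λ _ → 0) λ _ _ → refl)
∑-swap (suc m) n f = trans (cong (∑ n (f 1) +_) (∑-swap m n (f ∘ suc)))
  (sym (∑-distrib-+ n (f 1) (λ j → ∑ m (λ i → f (suc i) j))))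

-- Boolean tests, colour classes and single triples

≤ᵇ-true : ∀ {m n} → m ≤ n → (m ≤ᵇ n) ≡ true
≤ᵇ-true m≤n = Equivalence.to T-≡ (≤⇒≤ᵇ m≤n)

¬T⇒false : ∀ {b} → ¬ T b → b ≡ false
¬T⇒false {false} _ = refl
¬T⇒false {true}  h = contradiction _ h

≤ᵇ-false : ∀ {m n} → n < m → (m ≤ᵇ n) ≡ false
≤ᵇ-false {m} {n} n<m = ¬T⇒false (<⇒≱ n<m ∘ ≤ᵇ⇒≤ m n)

<ᵇ-true : ∀ {m n} → m < n → (m <ᵇ n) ≡ true
<ᵇ-true m<n = Equivalence.to T-≡ (<⇒<ᵇ m<n)

<ᵇ-false : ∀ {m n} → n ≤ m → (m <ᵇ n) ≡ false
<ᵇ-false {m} {n} n≤m = ¬T⇒false (≤⇒≯ n≤m ∘ <ᵇ⇒< m n)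

-- While `d < m`, peeling off x = 1 lowers `k` by one and raises `d` by one, so both sides drop by
-- one; once `m ≤ d` every term vanishes.
∑-count-≤ : ∀ k d m → ∑ k (λ x → count (x + d ≤ᵇ m)) ≡ k ⊓ (m ∸ d)
∑-count-≤ zero    d m = refl
∑-count-≤ (suc k) d m with d <? m
... | yes d<m = trans
  (cong₂ _+_ (cong count (≤ᵇ-true d<m))
    (trans (∑-cong k {g = λ x → count (x + suc d ≤ᵇ m)} λ i _ → cong (λ v → count (v ≤ᵇ m)) (sym (+-suc (suc i) d)))
      (∑-count-≤ k (suc d) m)))
  (cong (suc k ⊓_) (sym (+-∸-assoc 1 d<m)))
... | no d≮m = trans
  (∑-zero (suc k) (λ x → count (x + d ≤ᵇ m)) λ i _ → cong count (≤ᵇ-false (s≤s (≤-trans (≮⇒≥ d≮m) (m≤n+m d i)))))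
  (sym (cong (suc k ⊓_) (m≤n⇒m∸n≡0 (≮⇒≥ d≮m))))

∑-count-≤ᵇ+ : ∀ k a d m → ∑ k (λ x → count (a + x + d ≤ᵇ a + m)) ≡ k ⊓ (m ∸ d)
∑-count-≤ᵇ+ k a d m = trans (∑-cong k λ i _ → cong count (shift a (suc i))) (∑-count-≤ k d m)
  where
  shift : ∀ a i → (a + i + d ≤ᵇ a + m) ≡ (i + d ≤ᵇ m)
  shift a i with i + d ≤? m
  ... | yes p = trans (≤ᵇ-true (subst (_≤ a + m) (sym (+-assoc a i d)) (+-monoʳ-≤ a p))) (sym (≤ᵇ-true p))
  ... | no ¬p = trans (≤ᵇ-false (subst (a + m <_) (sym (+-assoc a i d)) (+-monoʳ-< a (≰⇒> ¬p))))
    (sym (≤ᵇ-false (≰⇒> ¬p)))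

module _ {n s t : ℕ} (s≤t : s ≤ t) (t≤n : t ≤ n) where

  -- The values of all three tests are bundled, so that rewriting with them reduces `good`.
  Red Blue : ℕ → Set
  Red  v = inN n v ≡ true × isRed n s t v ≡ true  × isBlue s t v ≡ false
  Blue v = inN n v ≡ true × isRed n s t v ≡ false × isBlue s t v ≡ true

  low⇒Red : ∀ {v} → v < s → Red (suc v)
  low⇒Red {v} v<s = ≤ᵇ-true (≤-trans v<s (≤-trans s≤t t≤n)) , red , blue
    where
    red : isRed n s t (suc v) ≡ true
    red rewrite ≤ᵇ-true v<s = refl
    blue : isBlue s t (suc v) ≡ false
    blue rewrite <ᵇ-false v<s = refl

  mid⇒Blue : ∀ {v} → s ≤ v → v < t → Blue (suc v)
  mid⇒Blue {v} s≤v v<t = ≤ᵇ-true (≤-trans v<t t≤n) , red , blue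
    where
    red : isRed n s t (suc v) ≡ false
    red rewrite ≤ᵇ-false (s≤s s≤v) | <ᵇ-false v<t = refl
    blue : isBlue s t (suc v) ≡ true
    blue rewrite <ᵇ-true (s≤s s≤v) | ≤ᵇ-true v<t = refl

  high⇒Red : ∀ {v} → t ≤ v → v < n → Red (suc v)
  high⇒Red {v} t≤v v<n = ≤ᵇ-true v<n , red , blue
    where
    red : isRed n s t (suc v) ≡ true
    red rewrite ≤ᵇ-false (s≤s (≤-trans s≤t t≤v)) | <ᵇ-true (s≤s t≤v) | ≤ᵇ-true v<n = refl
    blue : isBlue s t (suc v) ≡ false
    blue rewrite <ᵇ-true (s≤s (≤-trans s≤t t≤v)) | ≤ᵇ-false (s≤s t≤v) = refl

  good-red : ∀ x y → Red x → Red y →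
             good n s t x y ≡ inN n (x + 4 * y) ∧ isRed n s t (x + 4 * y)
  good-red x y (ix , rx , bx) (iy , ry , by)
    rewrite ix | iy | rx | ry | bx = cong (inN n (x + 4 * y) ∧_) (∨-identityʳ _)

  good-blue : ∀ x y → Blue x → Blue y →
              good n s t x y ≡ inN n (x + 4 * y) ∧ isBlue s t (x + 4 * y)
  good-blue _ _ (ix , rx , bx) (iy , ry , by) rewrite ix | iy | rx | bx | by = refl

  good-blue-red : ∀ x y → Blue x → Red y → good n s t x y ≡ false
  good-blue-red _ _ (ix , rx , bx) (iy , ry , by)
    rewrite ix | iy | rx | bx | by = ∧-zeroʳ _

  good-red-blue : ∀ x y → Red x → Blue y → good n s t x y ≡ false
  good-red-blue _ _ (ix , rx , bx) (iy , ry , by)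
    rewrite ix | iy | rx | ry | bx = ∧-zeroʳ _

  -- Stated additively, so that truncated subtraction only enters after summation over x.
  count-low-low : ∀ {x y} → x < s → Red (suc y) →
    let z = suc x + 4 * suc y in
    count (good n s t (suc x) (suc y)) + count (z ≤ᵇ t) ≡ count (z ≤ᵇ s) + count (z ≤ᵇ n)
  count-low-low {x} {y} x<s Ry =
    trans (cong (λ b → count b + _) (good-red (suc x) (suc y) (low⇒Red x<s) Ry)) (go (x + 4 * suc y))
    where
    go : ∀ z → count (inN n (suc z) ∧ isRed n s t (suc z)) + count (suc z ≤ᵇ t)
             ≡ count (suc z ≤ᵇ s) + count (suc z ≤ᵇ n)
    go z with z <? s | z <? t | z <? n
    ... | yes z<s | _ | _
      rewrite ≤ᵇ-true z<s | ≤ᵇ-true (≤-trans z<s s≤t) | ≤ᵇ-true (≤-trans z<s (≤-trans s≤t t≤n)) = refl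
    ... | no z≮s | yes z<t | _
      rewrite ≤ᵇ-false (s≤s (≮⇒≥ z≮s)) | ≤ᵇ-true z<t | <ᵇ-false z<t | ≤ᵇ-true (≤-trans z<t t≤n) = refl
    ... | no z≮s | no z≮t | yes z<n
      rewrite ≤ᵇ-false (s≤s (≮⇒≥ z≮s)) | ≤ᵇ-false (s≤s (≮⇒≥ z≮t)) | <ᵇ-true (s≤s (≮⇒≥ z≮t)) | ≤ᵇ-true z<n = refl
    ... | no z≮s | no z≮t | no z≮n
      rewrite ≤ᵇ-false (s≤s (≮⇒≥ z≮s)) | ≤ᵇ-false (s≤s (≮⇒≥ z≮t)) | ≤ᵇ-false (s≤s (≮⇒≥ z≮n)) = refl

  -- The hypothesis `t ≤ x + 4 * suc y` says z > t, and beyond `t` the only obstruction to z being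
  -- red is z > n.
  count-red-high : ∀ {x y} → Red (suc x) → Red (suc y) → t ≤ x + 4 * suc y →
    count (good n s t (suc x) (suc y)) ≡ count (suc x + 4 * suc y ≤ᵇ n)
  count-red-high {x} {y} Rx Ry t≤z =
    cong count (trans (good-red (suc x) (suc y) Rx Ry) (go (x + 4 * suc y) t≤z))
    where
    go : ∀ z → t ≤ z → inN n (suc z) ∧ isRed n s t (suc z) ≡ (suc z ≤ᵇ n)
    go z t≤z rewrite ≤ᵇ-false (s≤s (≤-trans s≤t t≤z)) | <ᵇ-true (s≤s t≤z) = ∧-idem _

  -- As z > x > s, a sum of two blue numbers can leave the blue block only at its upper end.
  count-mid-mid : ∀ {x y} → s ≤ x → x < t → s ≤ y → y < t →
    count (good n s t (suc x) (suc y)) ≡ count (suc x + 4 * suc y ≤ᵇ t)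
  count-mid-mid {x} {y} s≤x x<t s≤y y<t =
    cong count (trans (good-blue (suc x) (suc y) (mid⇒Blue s≤x x<t) (mid⇒Blue s≤y y<t))
      (go (x + 4 * suc y) (≤-trans s≤x (m≤m+n x _))))
    where
    go : ∀ z → s ≤ z → inN n (suc z) ∧ isBlue s t (suc z) ≡ (suc z ≤ᵇ t)
    go z s≤z with z <? t
    ... | yes z<t rewrite <ᵇ-true (s≤s s≤z) | ≤ᵇ-true z<t | ≤ᵇ-true (≤-trans z<t t≤n) = refl
    ... | no z≮t rewrite <ᵇ-true (s≤s s≤z) | ≤ᵇ-false (s≤s (≮⇒≥ z≮t)) = ∧-zeroʳ _

-- Row sums for colour blocks of lengths s, g and c

module _ (s g c : ℕ) where

  private
    -- Taking block lengths as parameters makes `t` and `n` sums, so that `∑-split` cuts a row into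
    -- blocks without truncated subtraction.
    t n : ℕ
    t = s + g
    n = t + c

    s≤t : s ≤ t
    s≤t = m≤m+n s g

    t≤n : t ≤ n
    t≤n = m≤m+n t c

    -- The argument y comes first: for fixed y, every condition z ≤ m cuts out an initial segment of
    -- the x.
    cell : ℕ → ℕ → ℕ
    cell y x = count (good n s t x y)

    mid<t : ∀ {i} → i < g → s + i < t
    mid<t = +-monoʳ-< s

    high<n : ∀ {i} → i < c → t + i < n
    high<n = +-monoʳ-< t

    Red′ : ℕ → Set
    Red′ = Red s≤t t≤n

    at-suc : ∀ (P : ℕ → Set) m i → P (suc (m + i)) → P (m + suc i)
    at-suc P m i = subst P (sym (+-suc m i))

  row-split : ∀ y → ∑ n (cell y) ≡
    ∑ s (cell y) + ∑ g (λ x → cell y (s + x)) + ∑ c (λ x → cell y (t + x))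
  row-split y = trans (∑-split t c (cell y))
    (cong (_+ ∑ c (λ x → cell y (t + x))) (∑-split s g (cell y)))

  row-low-low : ∀ {y} → y < s → ∑ s (cell (suc y)) + s ⊓ (t ∸ 4 * suc y) ≡
    (s ∸ 4 * suc y) + s ⊓ (n ∸ 4 * suc y)
  row-low-low {y} y<s = begin
    ∑ s (cell Y) + s ⊓ (t ∸ 4 * Y)
      ≡⟨ cong (∑ s (cell Y) +_) (∑-count-≤ s (4 * Y) t) ⟨
    ∑ s (cell Y) + ∑ s (upTo t)
      ≡⟨ ∑-distrib-+ s (cell Y) (upTo t) ⟨
    ∑ s (λ x → cell Y x + upTo t x)
      ≡⟨ ∑-cong s (λ x x<s → count-low-low s≤t t≤n x<s (low⇒Red s≤t t≤n y<s)) ⟩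
    ∑ s (λ x → upTo s x + upTo n x)
      ≡⟨ ∑-distrib-+ s (upTo s) (upTo n) ⟩
    ∑ s (upTo s) + ∑ s (upTo n)
      ≡⟨ cong₂ _+_ (trans (∑-count-≤ s (4 * Y) s) (m≥n⇒m⊓n≡n (m∸n≤m s (4 * Y))))
           (∑-count-≤ s (4 * Y) n) ⟩
    (s ∸ 4 * Y) + s ⊓ (n ∸ 4 * Y) ∎
    where
    open ≡-Reasoning
    Y = suc y
    upTo : ℕ → ℕ → ℕ
    upTo m x = count (x + 4 * Y ≤ᵇ m)

  row-mid-red : ∀ {y} → Red′ (suc y) → ∑ g (λ x → cell (suc y) (s + x)) ≡ 0
  row-mid-red {y} Ry = ∑-zero g (λ x → cell (suc y) (s + x)) λ i i<g →
    at-suc (λ x → cell (suc y) x ≡ 0) s i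
      (cong count (good-blue-red s≤t t≤n (suc (s + i)) (suc y)
        (mid⇒Blue s≤t t≤n (m≤m+n s i) (mid<t i<g)) Ry))

  row-high-red : ∀ {y} → Red′ (suc y) → ∑ c (λ x → cell (suc y) (t + x)) ≡ c ∸ 4 * suc y
  row-high-red {y} Ry = begin
    ∑ c (λ x → cell (suc y) (t + x))
      ≡⟨ ∑-cong c (λ i i<c → at-suc (λ x → cell (suc y) x ≡ count (x + 4 * suc y ≤ᵇ n)) t i
           (count-red-high s≤t t≤n (high⇒Red s≤t t≤n (m≤m+n t i) (high<n i<c)) Ry
             (≤-trans (m≤m+n t i) (m≤m+n (t + i) _)))) ⟩
    ∑ c (λ x → count (t + x + 4 * suc y ≤ᵇ n))
      ≡⟨ ∑-count-≤ᵇ+ c t (4 * suc y) c ⟩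
    c ⊓ (c ∸ 4 * suc y)
      ≡⟨ m≥n⇒m⊓n≡n (m∸n≤m c (4 * suc y)) ⟩
    c ∸ 4 * suc y ∎
    where open ≡-Reasoning

  -- For y ≤ s the summands come from x ≤ s with z ≤ s, from x ≤ s with z > t, and from x > t; blue
  -- x give nothing.
  row-low : ∀ y → y < s → ∑ n (cell (suc y)) ≡
    (s ∸ 4 * suc y) + (s ⊓ (n ∸ 4 * suc y) ∸ s ⊓ (t ∸ 4 * suc y)) + (c ∸ 4 * suc y)
  row-low y y<s = begin
    ∑ n (cell Y)
      ≡⟨ row-split Y ⟩
    ∑ s (cell Y) + ∑ g (λ x → cell Y (s + x)) + ∑ c (λ x → cell Y (t + x))
      ≡⟨ cong₂ (λ a b → ∑ s (cell Y) + a + b) (row-mid-red Ry) (row-high-red Ry) ⟩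
    ∑ s (cell Y) + 0 + (c ∸ 4 * Y)
      ≡⟨ cong (_+ (c ∸ 4 * Y)) (+-identityʳ _) ⟩
    ∑ s (cell Y) + (c ∸ 4 * Y)
      ≡⟨ cong (_+ (c ∸ 4 * Y)) low-low ⟩
    (s ∸ 4 * Y) + (s ⊓ (n ∸ 4 * Y) ∸ s ⊓ (t ∸ 4 * Y)) + (c ∸ 4 * Y) ∎
    where
    open ≡-Reasoning
    Y = suc y
    Ry = low⇒Red s≤t t≤n y<s
    low-low : ∑ s (cell Y) ≡ (s ∸ 4 * Y) + (s ⊓ (n ∸ 4 * Y) ∸ s ⊓ (t ∸ 4 * Y))
    low-low = begin
      ∑ s (cell Y)
        ≡⟨ m+n∸n≡m _ (s ⊓ (t ∸ 4 * Y)) ⟨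
      ∑ s (cell Y) + s ⊓ (t ∸ 4 * Y) ∸ s ⊓ (t ∸ 4 * Y)
        ≡⟨ cong (_∸ s ⊓ (t ∸ 4 * Y)) (row-low-low y<s) ⟩
      (s ∸ 4 * Y) + s ⊓ (n ∸ 4 * Y) ∸ s ⊓ (t ∸ 4 * Y)
        ≡⟨ +-∸-assoc (s ∸ 4 * Y) (⊓-monoʳ-≤ s (∸-monoˡ-≤ (4 * Y) t≤n)) ⟩
      (s ∸ 4 * Y) + (s ⊓ (n ∸ 4 * Y) ∸ s ⊓ (t ∸ 4 * Y)) ∎

  -- Measured from s, the condition z ≤ t reads x' + 4y' ≤ g - 4s, so blue triples behave like those
  -- of an initial segment of length g - 4s.
  row-mid : ∀ y → y < g → ∑ n (cell (s + suc y)) ≡ (g ∸ 4 * s) ∸ 4 * suc y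
  row-mid y y<g = begin
    ∑ n (cell Y)
      ≡⟨ row-split Y ⟩
    ∑ s (cell Y) + ∑ g (λ x → cell Y (s + x)) + ∑ c (λ x → cell Y (t + x))
      ≡⟨ cong₂ _+_ (cong₂ _+_ low mid) high ⟩
    ((g ∸ 4 * s) ∸ 4 * suc y) + 0
      ≡⟨ +-identityʳ _ ⟩
    (g ∸ 4 * s) ∸ 4 * suc y ∎
    where
    open ≡-Reasoning
    Y = s + suc y
    By : Blue s≤t t≤n Y
    By = at-suc (Blue s≤t t≤n) s y (mid⇒Blue s≤t t≤n (m≤m+n s y) (mid<t y<g))
    low : ∑ s (cell Y) ≡ 0
    low = ∑-zero s (cell Y) λ i i<s →
      cong count (good-red-blue s≤t t≤n (suc i) Y (low⇒Red s≤t t≤n i<s) By)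
    high : ∑ c (λ x → cell Y (t + x)) ≡ 0
    high = ∑-zero c (λ x → cell Y (t + x)) λ i i<c →
      at-suc (λ x → cell Y x ≡ 0) t i (cong count (good-red-blue s≤t t≤n (suc (t + i)) Y
        (high⇒Red s≤t t≤n (m≤m+n t i) (high<n i<c)) By))
    mid : ∑ g (λ x → cell Y (s + x)) ≡ (g ∸ 4 * s) ∸ 4 * suc y
    mid = begin
      ∑ g (λ x → cell Y (s + x))
        ≡⟨ ∑-cong g (λ i i<g → at-suc (λ x → cell Y x ≡ count (x + 4 * Y ≤ᵇ t)) s i
             (subst (λ Y → cell Y (suc (s + i)) ≡ count (suc (s + i) + 4 * Y ≤ᵇ t)) (sym (+-suc s y))
               (count-mid-mid s≤t t≤n (m≤m+n s i) (mid<t i<g) (m≤m+n s y) (mid<t y<g)))) ⟩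
      ∑ g (λ x → count (s + x + 4 * Y ≤ᵇ t))
        ≡⟨ ∑-count-≤ᵇ+ g s (4 * Y) g ⟩
      g ⊓ (g ∸ 4 * Y)
        ≡⟨ m≥n⇒m⊓n≡n (m∸n≤m g (4 * Y)) ⟩
      g ∸ 4 * Y
        ≡⟨ cong (g ∸_) (*-distribˡ-+ 4 s (suc y)) ⟩
      g ∸ (4 * s + 4 * suc y)
        ≡⟨ ∸-+-assoc g (4 * s) (4 * suc y) ⟨
      (g ∸ 4 * s) ∸ 4 * suc y ∎

  -- Here y > t forces z > t, so only z ≤ n remains to be checked, separately for x in the two red
  -- blocks.
  row-high : ∀ y → y < c → ∑ n (cell (t + suc y)) ≡
    s ⊓ (n ∸ 4 * (t + suc y)) + (c ∸ 4 * (t + suc y))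
  row-high y y<c = subst
    (λ Y → ∑ n (cell Y) ≡ s ⊓ (n ∸ 4 * Y) + (c ∸ 4 * Y)) (sym (+-suc t y)) (begin
    ∑ n (cell Y)
      ≡⟨ row-split Y ⟩
    ∑ s (cell Y) + ∑ g (λ x → cell Y (s + x)) + ∑ c (λ x → cell Y (t + x))
      ≡⟨ cong₂ (λ a b → ∑ s (cell Y) + a + b) (row-mid-red Ry) (row-high-red Ry) ⟩
    ∑ s (cell Y) + 0 + (c ∸ 4 * Y)
      ≡⟨ cong (_+ (c ∸ 4 * Y)) (+-identityʳ _) ⟩
    ∑ s (cell Y) + (c ∸ 4 * Y)
      ≡⟨ cong (_+ (c ∸ 4 * Y)) (∑-cong s λ i i<s →
           count-red-high s≤t t≤n (low⇒Red s≤t t≤n i<s) Ry (t≤z i)) ⟩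
    ∑ s (λ x → count (x + 4 * Y ≤ᵇ n)) + (c ∸ 4 * Y)
      ≡⟨ cong (_+ (c ∸ 4 * Y)) (∑-count-≤ s (4 * Y) n) ⟩
    s ⊓ (n ∸ 4 * Y) + (c ∸ 4 * Y) ∎)
    where
    open ≡-Reasoning
    Y = suc (t + y)
    Ry = high⇒Red s≤t t≤n (m≤m+n t y) (high<n y<c)
    t≤z : ∀ i → t ≤ i + 4 * Y
    t≤z i = ≤-trans (m≤m+n t y) (≤-trans (n≤1+n (t + y)) (≤-trans (m≤n*m Y 4) (m≤n+m (4 * Y) i)))

  -- Triples with x, y ≤ s and z > t, and triples with y > t.
  crossing high-y : ℕ
  crossing = ∑ s (λ y → s ⊓ (n ∸ 4 * y) ∸ s ⊓ (t ∸ 4 * y))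
  high-y = ∑ c (λ y → s ⊓ (n ∸ 4 * (t + y)) + (c ∸ 4 * (t + y)))

  M4-rows : M4 n s t ≡
    ∑ s (λ y → s ∸ 4 * y) + crossing + ∑ s (λ y → c ∸ 4 * y)
      + ∑ g (λ y → (g ∸ 4 * s) ∸ 4 * y) + high-y
  M4-rows = begin
    M4 n s t
      ≡⟨ sum-applyUpTo (λ x → sum (map (λ y → cell y x) (range n))) (λ v → v) n ⟩
    ∑ n (λ x → sum (map (λ y → cell y x) (range n)))
      ≡⟨ ∑-cong n (λ x _ → sum-applyUpTo (λ y → cell y (suc x)) (λ v → v) n) ⟩
    ∑ n (λ x → ∑ n (λ y → cell y x))
      ≡⟨ ∑-swap n n (λ x y → cell y x) ⟩
    ∑ n (λ y → ∑ n (cell y))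
      ≡⟨ ∑-split t c _ ⟩
    ∑ t (λ y → ∑ n (cell y)) + ∑ c (λ y → ∑ n (cell (t + y)))
      ≡⟨ cong₂ _+_ (∑-split s g _) (∑-cong c row-high) ⟩
    ∑ s (λ y → ∑ n (cell y)) + ∑ g (λ y → ∑ n (cell (s + y))) + high-y
      ≡⟨ cong₂ (λ a b → a + b + high-y) low (∑-cong g row-mid) ⟩
    _ ∎
    where
    open ≡-Reasoning
    low : ∑ s (λ y → ∑ n (cell y)) ≡ ∑ s (λ y → s ∸ 4 * y) + crossing + ∑ s (λ y → c ∸ 4 * y)
    low = trans (∑-cong s row-low) (trans (∑-distrib-+ s
      (λ y → (s ∸ 4 * y) + (s ⊓ (n ∸ 4 * y) ∸ s ⊓ (t ∸ 4 * y))) (λ y → c ∸ 4 * y))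
      (cong (_+ ∑ s (λ y → c ∸ 4 * y))
        (∑-distrib-+ s (λ y → s ∸ 4 * y) (λ y → s ⊓ (n ∸ 4 * y) ∸ s ⊓ (t ∸ 4 * y)))))

-- Closed forms for the row sums

-- The number of pairs x, y ≥ 1 with x + 4y ≤ m.
tri : ℕ → ℕ
tri 0 = 0
tri 1 = 0
tri 2 = 0
tri 3 = 0
tri (suc (suc (suc (suc m)))) = m + tri m

4+m∸4[1+y] : ∀ m y → 4 + m ∸ 4 * suc y ≡ m ∸ 4 * y
4+m∸4[1+y] m y = cong (4 + m ∸_) (*-suc 4 y)

∑-small : ∀ k {m} → m ≤ 4 → ∑ k (λ y → m ∸ 4 * y) ≡ 0
∑-small k {m} m≤4 = ∑-zero k (λ y → m ∸ 4 * y) λ i _ →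
  m≤n⇒m∸n≡0 (≤-trans m≤4 (m≤m*n 4 (suc i)))

-- The hypothesis says that rows y > k would be empty, so stopping at k loses nothing.
∑-tri : ∀ k m → m ≤ 4 * k + 4 → ∑ k (λ y → m ∸ 4 * y) ≡ tri m
∑-tri zero    0 _ = refl
∑-tri zero    1 _ = refl
∑-tri zero    2 _ = refl
∑-tri zero    3 _ = refl
∑-tri zero    4 _ = refl
∑-tri zero    (suc (suc (suc (suc (suc _))))) (s≤s (s≤s (s≤s (s≤s ()))))
∑-tri (suc k) 0 _ = ∑-small (suc k) z≤n
∑-tri (suc k) 1 _ = ∑-small (suc k) (s≤s z≤n)
∑-tri (suc k) 2 _ = ∑-small (suc k) (s≤s (s≤s z≤n))
∑-tri (suc k) 3 _ = ∑-small (suc k) (s≤s (s≤s (s≤s z≤n)))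
∑-tri (suc k) (suc (suc (suc (suc m)))) m≤ = cong (m +_)
  (trans (∑-cong k λ i _ → 4+m∸4[1+y] m (suc i))
    (∑-tri k m (+-cancelˡ-≤ 4 m (4 * k + 4) (subst (4 + m ≤_) (eq k) m≤))))
  where
  eq : ∀ k → 4 * suc k + 4 ≡ 4 + (4 * k + 4)
  eq = solve-∀

-- Substitute y ↦ k + 1 - y.
∑-reverse : ∀ k m → ∑ k (λ y → 4 * y + m ∸ 4 * suc k) ≡ ∑ k (λ y → m ∸ 4 * y)
∑-reverse zero    m = refl
∑-reverse (suc k) m = begin
  (4 + m ∸ 4 * suc (suc k)) + ∑ k (λ y → 4 * suc y + m ∸ 4 * suc (suc k))
    ≡⟨ cong₂ _+_ (4+m∸4[1+y] m (suc k)) (∑-cong k λ i _ →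
         trans (cong (λ v → v + m ∸ 4 * suc (suc k)) (*-suc 4 (suc i))) (4+m∸4[1+y] (4 * suc i + m) (suc k))) ⟩
  (m ∸ 4 * suc k) + ∑ k (λ y → 4 * y + m ∸ 4 * suc k)
    ≡⟨ cong ((m ∸ 4 * suc k) +_) (∑-reverse k m) ⟩
  (m ∸ 4 * suc k) + ∑ k (λ y → m ∸ 4 * y)
    ≡⟨ +-comm (m ∸ 4 * suc k) _ ⟩
  ∑ k (λ y → m ∸ 4 * y) + (m ∸ 4 * suc k)
    ≡⟨ ∑-last k (λ y → m ∸ 4 * y) ⟨
  ∑ (suc k) (λ y → m ∸ 4 * y) ∎
  where open ≡-Reasoning

-- Each term is at least m - 4y, and these sum to km - 2k(k + 1). This serves the range c > 4s + 4,
-- outside the reach of `∑-tri`.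
∑-linear-≤ : ∀ k m → k * m ≤ ∑ k (λ y → m ∸ 4 * y) + 2 * (k * suc k)
∑-linear-≤ zero    m = z≤n
∑-linear-≤ (suc k) m = begin
  m + k * m
    ≤⟨ +-mono-≤ m≤ (*-monoʳ-≤ k m≤) ⟩
  4 + (m ∸ 4) + k * (4 + (m ∸ 4))
    ≡⟨ eq₁ (m ∸ 4) k ⟩
  4 + 4 * k + (m ∸ 4) + k * (m ∸ 4)
    ≤⟨ +-monoʳ-≤ (4 + 4 * k + (m ∸ 4)) (∑-linear-≤ k (m ∸ 4)) ⟩
  4 + 4 * k + (m ∸ 4) + (∑ k (λ y → m ∸ 4 ∸ 4 * y) + 2 * (k * suc k))
    ≡⟨ eq₂ (m ∸ 4) k (∑ k (λ y → m ∸ 4 ∸ 4 * y)) ⟩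
  (m ∸ 4) + ∑ k (λ y → m ∸ 4 ∸ 4 * y) + 2 * (suc k * suc (suc k))
    ≡⟨ cong (λ v → (m ∸ 4) + v + 2 * (suc k * suc (suc k))) (∑-cong k λ i _ →
         trans (∸-+-assoc m 4 (4 * suc i)) (cong (m ∸_) (sym (*-suc 4 (suc i))))) ⟩
  (m ∸ 4) + ∑ k (λ y → m ∸ 4 * suc y) + 2 * (suc k * suc (suc k)) ∎
  where
  open ≤-Reasoning
  m≤ : m ≤ 4 + (m ∸ 4)
  m≤ = m≤n+m∸n m 4
  eq₁ : ∀ a k → 4 + a + k * (4 + a) ≡ 4 + 4 * k + a + k * a
  eq₁ = solve-∀
  eq₂ : ∀ a k b → 4 + 4 * k + a + (b + 2 * (k * suc k)) ≡ a + b + 2 * (suc k * suc (suc k))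
  eq₂ = solve-∀

-- Lower bounds and an exact formula for the count

module _ (s g c : ℕ) where

  private
    t n : ℕ
    t = s + g
    n = t + c

  M4-tri : M4 n s t ≡
    tri s + crossing s g c + ∑ s (λ y → c ∸ 4 * y) + tri (g ∸ 4 * s) + high-y s g c
  M4-tri = trans (M4-rows s g c)
    (cong₂ (λ a b → a + crossing s g c + ∑ s (λ y → c ∸ 4 * y) + b + high-y s g c)
      (∑-tri s s (≤-trans (m≤n*m s 4) (m≤m+n (4 * s) 4)))
      (∑-tri g (g ∸ 4 * s) (≤-trans (m∸n≤m g (4 * s)) (≤-trans (m≤n*m g 4) (m≤m+n (4 * g) 4)))))

  M4-lower : ∀ {x h w} → x ≤ crossing s g c → h ≤ ∑ s (λ y → c ∸ 4 * y) → w ≤ high-y s g c →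
    tri s + x + h + tri (g ∸ 4 * s) + w ≤ M4 n s t
  M4-lower x≤ h≤ w≤ = ≤-trans
    (+-mono-≤ (+-monoˡ-≤ (tri (g ∸ 4 * s)) (+-mono-≤ (+-monoʳ-≤ (tri s) x≤) h≤)) w≤)
    (≤-reflexive (sym M4-tri))

  -- By d ≤ s and d ≤ c, each row y ≤ s has 4y ≤ t and s + 4y ≤ n, so no sum exceeds n and at least
  -- 4y - g of them exceed t. Numbering the rows from y = s downwards turns 4y - g into 4 + d - 4y',
  -- a whole triangle.
  crossing-lower : ∀ {d} → g + d ≡ 4 * s → d ≤ s → d ≤ c → tri (4 + d) ≤ crossing s g c
  crossing-lower {d} g+d≡4s d≤s d≤c = begin
    tri (4 + d)
      ≡⟨ ∑-tri s (4 + d) 4+d≤ ⟨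
    ∑ s (λ y → 4 + d ∸ 4 * y)
      ≡⟨ ∑-reverse s (4 + d) ⟨
    ∑ s (λ y → 4 * y + (4 + d) ∸ 4 * suc s)
      ≤⟨ ∑-mono s term ⟩
    crossing s g c ∎
    where
    open ≤-Reasoning
    4+d≤ : 4 + d ≤ 4 * s + 4
    4+d≤ = subst (_≤ 4 * s + 4) (+-comm d 4) (+-monoˡ-≤ 4 (≤-trans d≤s (m≤n*m s 4)))
    4[1+s]≡ : 4 * suc s ≡ g + (4 + d)
    4[1+s]≡ = trans (*-suc 4 s) (trans (cong (4 +_) (sym g+d≡4s)) (eq g d))
      where
      eq : ∀ g d → 4 + (g + d) ≡ g + (4 + d)
      eq = solve-∀
    term : ∀ i → i < s → 4 * suc i + (4 + d) ∸ 4 * suc s ≤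
      s ⊓ (n ∸ 4 * suc i) ∸ s ⊓ (t ∸ 4 * suc i)
    term i i<s = begin
      4 * y + (4 + d) ∸ 4 * suc s
        ≡⟨ cong (4 * y + (4 + d) ∸_) 4[1+s]≡ ⟩
      4 * y + (4 + d) ∸ (g + (4 + d))
        ≡⟨ cong₂ _∸_ (+-comm (4 * y) (4 + d)) (+-comm g (4 + d)) ⟩
      4 + d + 4 * y ∸ (4 + d + g)
        ≡⟨ [m+n]∸[m+o]≡n∸o (4 + d) (4 * y) g ⟩
      4 * y ∸ g
        ≤⟨ m≤n+o⇒m∸n≤o (4 * y) g 4y≤ ⟩
      s ∸ r
        ≤⟨ ∸-monoʳ-≤ s (m⊓n≤n s r) ⟩
      s ∸ s ⊓ r
        ≡⟨ cong (_∸ s ⊓ r) (m≤n⇒m⊓n≡m (m+n≤o⇒m≤o∸n s s+4y≤n)) ⟨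
      s ⊓ (n ∸ 4 * y) ∸ s ⊓ r ∎
      where
      y = suc i
      r = t ∸ 4 * y
      4y≤4s : 4 * y ≤ 4 * s
      4y≤4s = *-monoʳ-≤ 4 i<s
      4y≤t : 4 * y ≤ t
      4y≤t = ≤-trans 4y≤4s (≤-trans (≤-reflexive (sym g+d≡4s))
        (≤-trans (+-monoʳ-≤ g d≤s) (≤-reflexive (+-comm g s))))
      s+4y≤n : s + 4 * y ≤ n
      s+4y≤n = begin
        s + 4 * y    ≤⟨ +-monoʳ-≤ s 4y≤4s ⟩
        s + 4 * s    ≡⟨ cong (s +_) g+d≡4s ⟨
        s + (g + d)  ≤⟨ +-monoʳ-≤ s (+-monoʳ-≤ g d≤c) ⟩
        s + (g + c)  ≡⟨ +-assoc s g c ⟨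
        n            ∎
      4y≤ : 4 * y ≤ g + (s ∸ r)
      4y≤ = +-cancelʳ-≤ r (4 * y) (g + (s ∸ r)) (begin
        4 * y + r          ≡⟨ m+[n∸m]≡n 4y≤t ⟩
        s + g              ≤⟨ +-monoˡ-≤ g (m≤n+m∸n s r) ⟩
        r + (s ∸ r) + g    ≡⟨ eq r (s ∸ r) g ⟩
        g + (s ∸ r) + r    ∎)
        where
        eq : ∀ a b c → a + b + c ≡ c + b + a
        eq = solve-∀

  -- Row t + y holds at least c + s - v pairs, where v = 4(t + y): if v ≤ c, all of [s] fits because
  -- s ≤ t; if v ≥ c, the low block alone supplies that many.
  high-y-lower : tri (c + s ∸ 4 * t) ≤ high-y s g c
  high-y-lower = begin
    tri (c + s ∸ 4 * t)
      ≡⟨ ∑-tri c (c + s ∸ 4 * t) (m≤n+o⇒m∸n≤o (c + s) (4 * t) c+s≤) ⟨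
    ∑ c (λ y → c + s ∸ 4 * t ∸ 4 * y)
      ≤⟨ ∑-mono c (λ i _ → term (suc i)) ⟩
    high-y s g c ∎
    where
    open ≤-Reasoning
    s≤t : s ≤ t
    s≤t = m≤m+n s g
    c+s≤ : c + s ≤ 4 * t + (4 * c + 4)
    c+s≤ = begin
      c + s                  ≡⟨ +-comm c s ⟩
      s + c                  ≤⟨ +-mono-≤ (≤-trans s≤t (m≤n*m t 4)) (≤-trans (m≤n*m c 4) (m≤m+n (4 * c) 4)) ⟩
      4 * t + (4 * c + 4)    ∎
    term : ∀ y → c + s ∸ 4 * t ∸ 4 * y ≤ s ⊓ (n ∸ 4 * (t + y)) + (c ∸ 4 * (t + y))
    term y = begin
      c + s ∸ 4 * t ∸ 4 * y      ≡⟨ ∸-+-assoc (c + s) (4 * t) (4 * y) ⟩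
      c + s ∸ (4 * t + 4 * y)    ≡⟨ cong (c + s ∸_) (*-distribˡ-+ 4 t y) ⟨
      c + s ∸ v                  ≤⟨ cases (≤-total v c) ⟩
      s ⊓ (n ∸ v) + (c ∸ v)      ∎
      where
      v = 4 * (t + y)
      cases : v ≤ c ⊎ c ≤ v → c + s ∸ v ≤ s ⊓ (n ∸ v) + (c ∸ v)
      cases (inj₁ v≤c) = begin
        c + s ∸ v              ≡⟨ +-∸-comm s v≤c ⟩
        c ∸ v + s              ≡⟨ +-comm (c ∸ v) s ⟩
        s + (c ∸ v)            ≡⟨ cong (_+ (c ∸ v)) (m≤n⇒m⊓n≡m (m+n≤o⇒m≤o∸n s (+-mono-≤ s≤t v≤c))) ⟨
        s ⊓ (n ∸ v) + (c ∸ v)  ∎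
      cases (inj₂ c≤v) = begin
        c + s ∸ v              ≤⟨ ⊓-glb (m≤n+o⇒m∸n≤o (c + s) v (+-monoˡ-≤ s c≤v))
                                    (∸-monoˡ-≤ v (≤-trans (≤-reflexive (+-comm c s)) (+-monoˡ-≤ c s≤t))) ⟩
        s ⊓ (n ∸ v)            ≤⟨ m≤m+n _ _ ⟩
        s ⊓ (n ∸ v) + (c ∸ v)  ∎

  -- The first condition keeps sums from [s] at most 5s ≤ t, the second lets [s] supply every y that
  -- the last block can use, and the third leaves no room for y > t.
  M4-exact : 4 * s ≤ g → c ≤ 4 * s + 4 → n ≤ 4 * t + 4 →
    M4 n s t ≡ tri s + tri (g ∸ 4 * s) + tri c
  M4-exact 4s≤g c≤ n≤ = begin
    M4 n s t
      ≡⟨ M4-tri ⟩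
    tri s + crossing s g c + ∑ s (λ y → c ∸ 4 * y) + tri (g ∸ 4 * s) + high-y s g c
      ≡⟨ cong₂ (λ a b → tri s + a + ∑ s (λ y → c ∸ 4 * y) + tri (g ∸ 4 * s) + b) crossing≡0 high-y≡0 ⟩
    tri s + 0 + ∑ s (λ y → c ∸ 4 * y) + tri (g ∸ 4 * s) + 0
      ≡⟨ cong (λ h → tri s + 0 + h + tri (g ∸ 4 * s) + 0) (∑-tri s c c≤) ⟩
    tri s + 0 + tri c + tri (g ∸ 4 * s) + 0
      ≡⟨ eq (tri s) (tri c) (tri (g ∸ 4 * s)) ⟩
    tri s + tri (g ∸ 4 * s) + tri c ∎
    where
    open ≡-Reasoning
    eq : ∀ a b c → a + 0 + b + c + 0 ≡ a + c + b
    eq = solve-∀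
    crossing≡0 : crossing s g c ≡ 0
    crossing≡0 = ∑-zero s (λ y → s ⊓ (n ∸ 4 * y) ∸ s ⊓ (t ∸ 4 * y)) λ i i<s →
      m≤n⇒m∸n≡0 (≤-trans (m⊓n≤m s _) (≤-reflexive (sym (m≤n⇒m⊓n≡m
        (m+n≤o⇒m≤o∸n s (+-monoʳ-≤ s (≤-trans (*-monoʳ-≤ 4 i<s) 4s≤g)))))))
    high-y≡0 : high-y s g c ≡ 0
    high-y≡0 = ∑-zero c (λ y → s ⊓ (n ∸ 4 * (t + y)) + (c ∸ 4 * (t + y))) λ i _ →
      cong₂ _+_
        (trans (cong (s ⊓_) (m≤n⇒m∸n≡0 (n≤4[t+y] i))) (⊓-zeroʳ s))
        (m≤n⇒m∸n≡0 (≤-trans (m≤n+m c t) (n≤4[t+y] i)))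
      where
      n≤4[t+y] : ∀ i → n ≤ 4 * (t + suc i)
      n≤4[t+y] i = ≤-trans n≤ (≤-trans (+-monoʳ-≤ (4 * t) (m≤m*n 4 (suc i)))
        (≤-reflexive (sym (*-distribˡ-+ 4 t (suc i)))))

-- Integer quasi-polynomials

import Data.Integer.Base as ℤ
import Data.Integer.Properties as ℤ
import Data.Integer.Tactic.RingSolver as ℤ-Solver
open import Data.Integer using (ℤ; +_; -[1+_]; -_; 0ℤ; +≤+; +<+)
  renaming (_+_ to _⊹_; _*_ to _·_; _-_ to _−_; _≤_ to _≼_; _<_ to _≺_)
open import Data.Integer.DivMod using (_/ℕ_; _%ℕ_; n%ℕd<d; a≡a%ℕn+[a/ℕn]*n; [n/ℕd]*d≤n; n<s[n/ℕd]*d)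

infixl 6 _⊞_
infixl 7 _⊠_

_⊞_ : ∀ {i j} → 0ℤ ≼ i → 0ℤ ≼ j → 0ℤ ≼ i ⊹ j
_⊞_ = ℤ.+-mono-≤

_⊠_ : ∀ {i j} → 0ℤ ≼ i → 0ℤ ≼ j → 0ℤ ≼ i · j
_⊠_ {+ m} {+ n} _ _ = subst (0ℤ ≼_) (ℤ.pos-* m n) (+≤+ z≤n)

nonNeg : ∀ {n} → 0ℤ ≼ + n
nonNeg = +≤+ z≤n

square-nonNeg : ∀ i → 0ℤ ≼ i · i
square-nonNeg (+ n)    = nonNeg {n} ⊠ nonNeg {n}
square-nonNeg -[1+ n ] = +≤+ z≤n

diff : ∀ {i j} → i ≼ j → 0ℤ ≼ j − i
diff = ℤ.i≤j⇒0≤j-i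

-- The proof of `0ℤ ≼ e`, built with `_⊞_` and `_⊠_`, displays `e` as a sum of products of
-- nonnegative terms; what remains is a polynomial identity for the ring solver.
by-certificate : ∀ {i j e} → 0ℤ ≼ e → e ≡ j − i → i ≼ j
by-certificate 0≤e e≡ = ℤ.0≤i-j⇒j≤i (subst (0ℤ ≼_) e≡ 0≤e)

*-cancel-bounds : ∀ d .{{_ : NonZero d}} {p q} → p · + d ≺ ℤ.suc q · + d → p ≼ q
*-cancel-bounds (suc d) {p} {q} h = subst (p ≼_) (ℤ.pred-suc q)
  (ℤ.i<j⇒i≤pred[j] (ℤ.*-cancelʳ-<-nonNeg {p} {ℤ.suc q} (+ suc d) h))

/ℕ-unique : ∀ d .{{_ : NonZero d}} {n q r} → r < d → n ≡ + r ⊹ q · + d → n /ℕ d ≡ q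
/ℕ-unique d {n} {q} {r} r<d n≡ = ℤ.≤-antisym
  (*-cancel-bounds d (ℤ.≤-<-trans ([n/ℕd]*d≤n n d) n<))
  (*-cancel-bounds d (ℤ.≤-<-trans ≤n (n<s[n/ℕd]*d n d)))
  where
  ≤n : q · + d ≼ n
  ≤n = subst (q · + d ≼_) (sym n≡) (ℤ.i≤j+i (q · + d) (+ r))
  n< : n ≺ ℤ.suc q · + d
  n< = subst₂ _≺_ (sym n≡) (sym (ℤ.suc-* q (+ d))) (ℤ.+-monoˡ-< (q · + d) (+<+ r<d))

/ℕ-+-multiple : ∀ d .{{_ : NonZero d}} n k → (n ⊹ k · + d) /ℕ d ≡ n /ℕ d ⊹ k
/ℕ-+-multiple d n k = /ℕ-unique d (n%ℕd<d n d)
  (trans (cong (_⊹ k · + d) (a≡a%ℕn+[a/ℕn]*n n d)) (eq (+ (n %ℕ d)) (n /ℕ d) k (+ d)))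
  where
  eq : ∀ r q k d → r ⊹ q · d ⊹ k · d ≡ r ⊹ (q ⊹ k) · d
  eq = ℤ-Solver.solve-∀

%ℕ-+-multiple : ∀ d .{{_ : NonZero d}} n k → (n ⊹ k · + d) %ℕ d ≡ n %ℕ d
%ℕ-+-multiple d n k = ℤ.+-injective (begin
  + (m %ℕ d)
    ≡⟨ eq₁ (+ (m %ℕ d)) ((m /ℕ d) · + d) ⟩
  (+ (m %ℕ d) ⊹ (m /ℕ d) · + d) − (m /ℕ d) · + d
    ≡⟨ cong (_− (m /ℕ d) · + d) (a≡a%ℕn+[a/ℕn]*n m d) ⟨
  n ⊹ k · + d − (m /ℕ d) · + d
    ≡⟨ cong₂ (λ u v → u ⊹ k · + d − v · + d) (a≡a%ℕn+[a/ℕn]*n n d) (/ℕ-+-multiple d n k) ⟩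
  + (n %ℕ d) ⊹ (n /ℕ d) · + d ⊹ k · + d − (n /ℕ d ⊹ k) · + d
    ≡⟨ eq₂ (+ (n %ℕ d)) (n /ℕ d) k (+ d) ⟩
  + (n %ℕ d) ∎)
  where
  open ≡-Reasoning
  m = n ⊹ k · + d
  eq₁ : ∀ r q → r ≡ (r ⊹ q) − q
  eq₁ = ℤ-Solver.solve-∀
  eq₂ : ∀ r q k d → r ⊹ q · d ⊹ k · d − (q ⊹ k) · d ≡ r
  eq₂ = ℤ-Solver.solve-∀

-- The quasi-polynomial ⌊(x − 2)²/8⌋ extends tri to negative arguments.
quasi : ℤ → ℤ
quasi x = ((x − + 2) · (x − + 2)) /ℕ 8

-- The numerator changes by a multiple of 8, so the floor changes by an exact polynomial amount.
quasi-shift : ∀ x k → quasi (x ⊹ + 4 · k) ≡ quasi x ⊹ (k · (x − + 2) ⊹ + 2 · k · k)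
quasi-shift x k = trans (cong (_/ℕ 8) (eq x k))
  (/ℕ-+-multiple 8 ((x − + 2) · (x − + 2)) (k · (x − + 2) ⊹ + 2 · k · k))
  where
  eq : ∀ x k → (x ⊹ + 4 · k − + 2) · (x ⊹ + 4 · k − + 2) ≡
    (x − + 2) · (x − + 2) ⊹ (k · (x − + 2) ⊹ + 2 · k · k) · + 8
  eq = ℤ-Solver.solve-∀

quasi-reflect : ∀ x → quasi (- x) ≡ quasi (+ 4 ⊹ x)
quasi-reflect x = cong (_/ℕ 8) (eq x)
  where
  eq : ∀ x → (- x − + 2) · (- x − + 2) ≡ (+ 4 ⊹ x − + 2) · (+ 4 ⊹ x − + 2)
  eq = ℤ-Solver.solve-∀

quasi-tri : ∀ m → quasi (+ m) ≡ + tri m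
quasi-tri 0 = refl
quasi-tri 1 = refl
quasi-tri 2 = refl
quasi-tri 3 = refl
quasi-tri (suc (suc (suc (suc m)))) = begin
  quasi (+ (4 + m))
    ≡⟨ cong quasi (ℤ.+-comm (+ 4) (+ m)) ⟩
  quasi (+ m ⊹ + 4 · + 1)
    ≡⟨ quasi-shift (+ m) (+ 1) ⟩
  quasi (+ m) ⊹ (+ 1 · (+ m − + 2) ⊹ + 2 · + 1 · + 1)
    ≡⟨ cong (_⊹ (+ 1 · (+ m − + 2) ⊹ + 2 · + 1 · + 1)) (quasi-tri m) ⟩
  + tri m ⊹ (+ 1 · (+ m − + 2) ⊹ + 2 · + 1 · + 1)
    ≡⟨ eq (+ tri m) (+ m) ⟩
  + (m + tri m) ∎
  where
  open ≡-Reasoning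
  eq : ∀ t m → t ⊹ (+ 1 · (m − + 2) ⊹ + 2 · + 1 · + 1) ≡ m ⊹ t
  eq = ℤ-Solver.solve-∀

-- A square is 0, 1 or 4 modulo 8, so the floor discards at most 4/8. By `quasi-shift` four residues
-- decide.
quasi-lower : ∀ x → (x − + 2) · (x − + 2) ≼ + 8 · quasi x ⊹ + 4
quasi-lower x = by-certificate (base (n%ℕd<d x 4)) (begin
  + 8 · quasi r ⊹ + 4 − (r − + 2) · (r − + 2)
    ≡⟨ eq r k (quasi r) ⟨
  + 8 · (quasi r ⊹ (k · (r − + 2) ⊹ + 2 · k · k)) ⊹ + 4 − (r ⊹ + 4 · k − + 2) · (r ⊹ + 4 · k − + 2)
    ≡⟨ cong (λ v → + 8 · v ⊹ + 4 − (r ⊹ + 4 · k − + 2) · (r ⊹ + 4 · k − + 2)) (quasi-shift r k) ⟨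
  + 8 · quasi (r ⊹ + 4 · k) ⊹ + 4 − (r ⊹ + 4 · k − + 2) · (r ⊹ + 4 · k − + 2)
    ≡⟨ cong (λ x → + 8 · quasi x ⊹ + 4 − (x − + 2) · (x − + 2)) x≡ ⟨
  + 8 · quasi x ⊹ + 4 − (x − + 2) · (x − + 2) ∎)
  where
  open ≡-Reasoning
  r k : ℤ
  r = + (x %ℕ 4)
  k = x /ℕ 4
  x≡ : x ≡ r ⊹ + 4 · k
  x≡ = trans (a≡a%ℕn+[a/ℕn]*n x 4) (cong (r ⊹_) (ℤ.*-comm k (+ 4)))
  base : ∀ {i} → i < 4 → 0ℤ ≼ + 8 · quasi (+ i) ⊹ + 4 − (+ i − + 2) · (+ i − + 2)
  base = toWitness {a? = allUpTo? (λ i → 0ℤ ℤ.≤? (+ 8 · quasi (+ i) ⊹ + 4 − (+ i − + 2) · (+ i − + 2))) 4} _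
  eq : ∀ r k v → + 8 · (v ⊹ (k · (r − + 2) ⊹ + 2 · k · k)) ⊹ + 4 − (r ⊹ + 4 · k − + 2) · (r ⊹ + 4 · k − + 2) ≡
    + 8 · v ⊹ + 4 − (r − + 2) · (r − + 2)
  eq = ℤ-Solver.solve-∀

total : ℤ → ℤ → ℤ → ℤ
total a b c = quasi a ⊹ quasi b ⊹ quasi c

-- The increment depends on (a, b, c) only through 5a + b + c, and it is the increment in
-- `bound-shift`, since 5 · 20 + 4 + 4 = 108.
total-shift : ∀ a b c k → total (a ⊹ + 20 · k) (b ⊹ + 4 · k) (c ⊹ + 4 · k) ≡
  total a b c ⊹ (k · (+ 5 · a ⊹ b ⊹ c − + 14) ⊹ + 54 · k · k)
total-shift a b c k = begin
  quasi (a ⊹ + 20 · k) ⊹ quasi (b ⊹ + 4 · k) ⊹ quasi (c ⊹ + 4 · k)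
    ≡⟨ cong (λ v → quasi v ⊹ quasi (b ⊹ + 4 · k) ⊹ quasi (c ⊹ + 4 · k)) (eq₁ a k) ⟩
  quasi (a ⊹ + 4 · (+ 5 · k)) ⊹ quasi (b ⊹ + 4 · k) ⊹ quasi (c ⊹ + 4 · k)
    ≡⟨ cong₂ _⊹_ (cong₂ _⊹_ (quasi-shift a (+ 5 · k)) (quasi-shift b k)) (quasi-shift c k) ⟩
  _ ≡⟨ eq₂ (quasi a) (quasi b) (quasi c) a b c k ⟩
  total a b c ⊹ (k · (+ 5 · a ⊹ b ⊹ c − + 14) ⊹ + 54 · k · k) ∎
  where
  open ≡-Reasoning
  eq₁ : ∀ a k → a ⊹ + 20 · k ≡ a ⊹ + 4 · (+ 5 · k)
  eq₁ = ℤ-Solver.solve-∀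
  eq₂ : ∀ u v w a b c k →
    u ⊹ (+ 5 · k · (a − + 2) ⊹ + 2 · (+ 5 · k) · (+ 5 · k)) ⊹ (v ⊹ (k · (b − + 2) ⊹ + 2 · k · k))
      ⊹ (w ⊹ (k · (c − + 2) ⊹ + 2 · k · k)) ≡
    u ⊹ v ⊹ w ⊹ (k · (+ 5 · a ⊹ b ⊹ c − + 14) ⊹ + 54 · k · k)
  eq₂ = ℤ-Solver.solve-∀

-- The claimed minimum as a function on the integers

corr-cong : ∀ m n → m % 108 ≡ n % 108 → corr m ≡ corr n
corr-cong m n m≡n with (m % 108) ∈? I | (n % 108) ∈? I
... | yes _   | yes _   = refl
... | yes m∈I | no n∉I  = contradiction (subst (_∈ I) m≡n m∈I) n∉I
... | no m∉I  | yes n∈I = contradiction (subst (_∈ I) (sym m≡n) n∈I) m∉I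
... | no _    | no _    = refl

-- This extends `rhs4` to negative arguments, which occur when the finite check replaces b by its
-- residue modulo 4.
bound : ℤ → ℤ
bound x = (x · x − + 28 · x ⊹ + 245) /ℕ 216 − corr (x %ℕ 108)

rhs4≡bound : ∀ n → rhs4 n ≡ bound (+ n)
rhs4≡bound n = cong ((+ n · + n − + 28 · + n ⊹ + 245) /ℕ 216 −_)
  (corr-cong n (n % 108) (sym (m%n%n≡m%n n 108)))

bound-shift : ∀ x k → bound (x ⊹ + 108 · k) ≡ bound x ⊹ (k · (x − + 14) ⊹ + 54 · k · k)
bound-shift x k = begin
  bound (x ⊹ + 108 · k)
    ≡⟨ cong₂ (λ u r → u /ℕ 216 − corr r) (eq₁ x k)
         (trans (cong (λ v → (x ⊹ v) %ℕ 108) (ℤ.*-comm (+ 108) k)) (%ℕ-+-multiple 108 x k)) ⟩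
  (x · x − + 28 · x ⊹ + 245 ⊹ (k · (x − + 14) ⊹ + 54 · k · k) · + 216) /ℕ 216 − e
    ≡⟨ cong (_− e) (/ℕ-+-multiple 216 (x · x − + 28 · x ⊹ + 245) (k · (x − + 14) ⊹ + 54 · k · k)) ⟩
  (x · x − + 28 · x ⊹ + 245) /ℕ 216 ⊹ (k · (x − + 14) ⊹ + 54 · k · k) − e
    ≡⟨ eq₂ ((x · x − + 28 · x ⊹ + 245) /ℕ 216) (k · (x − + 14) ⊹ + 54 · k · k) e ⟩
  bound x ⊹ (k · (x − + 14) ⊹ + 54 · k · k) ∎
  where
  open ≡-Reasoning
  e = corr (x %ℕ 108)
  eq₁ : ∀ x k → (x ⊹ + 108 · k) · (x ⊹ + 108 · k) − + 28 · (x ⊹ + 108 · k) ⊹ + 245 ≡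
    x · x − + 28 · x ⊹ + 245 ⊹ (k · (x − + 14) ⊹ + 54 · k · k) · + 216
  eq₁ = ℤ-Solver.solve-∀
  eq₂ : ∀ u v e → u ⊹ v − e ≡ u − e ⊹ v
  eq₂ = ℤ-Solver.solve-∀

-- The numerator is (x - 14)² + 49, and 166 + 49 = 215 is the largest remainder modulo 216; the
-- correction only lowers the value.
bound-≤ : ∀ x {m} → (x − + 14) · (x − + 14) ≼ + 216 · m ⊹ + 166 → bound x ≼ m
bound-≤ x {m} h = ℤ.≤-trans (−corr≤ (x %ℕ 108)) (*-cancel-bounds 216
  (ℤ.≤-<-trans ([n/ℕd]*d≤n d 216) (ℤ.≤-<-trans d≤ (<suc m))))
  where
  d = x · x − + 28 · x ⊹ + 245
  −corr≤ : ∀ r → d /ℕ 216 − corr r ≼ d /ℕ 216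
  −corr≤ r with (r % 108) ∈? I
  ... | yes _ = ℤ.i-j≤i (d /ℕ 216) (+ 1)
  ... | no _  = ℤ.≤-reflexive (ℤ.+-identityʳ (d /ℕ 216))
  d≤ : d ≼ + 216 · m ⊹ + 215
  d≤ = by-certificate (diff h) (eq x m)
    where
    eq : ∀ x m → + 216 · m ⊹ + 166 − (x − + 14) · (x − + 14) ≡
      + 216 · m ⊹ + 215 − (x · x − + 28 · x ⊹ + 245)
    eq = ℤ-Solver.solve-∀
  <suc : ∀ m → + 216 · m ⊹ + 215 ≺ ℤ.suc m · + 216
  <suc m = ℤ.<-≤-trans (ℤ.+-monoʳ-< (+ 216 · m) (+<+ ≤-refl)) (ℤ.≤-reflexive (eq m))
    where
    eq : ∀ m → + 216 · m ⊹ + 216 ≡ (+ 1 ⊹ m) · + 216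
    eq = ℤ-Solver.solve-∀

-- Comparing the claimed minimum with the total

-- The 900 cases: a - 5b from -20 to 4, c - b from -4 to 4, and b modulo 4.
near-base : ∀ {p} → p < 25 → ∀ {q} → q < 9 → ∀ {j} → j < 4 →
  let a = + 5 · + j ⊹ (+ p − + 20); b = + j; c = + j ⊹ (+ q − + 4) in
  bound (+ 5 · a ⊹ b ⊹ c) ≼ total a b c
near-base = toWitness {a? = allUpTo? (λ p → allUpTo? (λ q → allUpTo? (λ j →
  let a = + 5 · + j ⊹ (+ p − + 20); b = + j; c = + j ⊹ (+ q − + 4) in
  bound (+ 5 · a ⊹ b ⊹ c) ℤ.≤? total a b c) 4) 9) 25} _

-- Lagrange's identity turns the spread of (a, b, c) into slack in (x − 14)² ≤ 216 m + 166.
far : ∀ a b c →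
  let p = a − + 5 · b ⊹ + 8; q = c − b in
  + 158 ≼ p · p ⊹ (p − + 5 · q) · (p − + 5 · q) ⊹ q · q →
  bound (+ 5 · a ⊹ b ⊹ c) ≼ total a b c
far a b c h = bound-≤ (+ 5 · a ⊹ b ⊹ c) (by-certificate
  (nonNeg {27} ⊠ (diff (quasi-lower a) ⊞ diff (quasi-lower b) ⊞ diff (quasi-lower c)) ⊞ diff h)
  (eq a b c (quasi a) (quasi b) (quasi c)))
  where
  eq : ∀ a b c u v w →
    + 27 · ((+ 8 · u ⊹ + 4 − (a − + 2) · (a − + 2)) ⊹ (+ 8 · v ⊹ + 4 − (b − + 2) · (b − + 2))
      ⊹ (+ 8 · w ⊹ + 4 − (c − + 2) · (c − + 2)))
    ⊹ ((a − + 5 · b ⊹ + 8) · (a − + 5 · b ⊹ + 8)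
      ⊹ (a − + 5 · b ⊹ + 8 − + 5 · (c − b)) · (a − + 5 · b ⊹ + 8 − + 5 · (c − b))
      ⊹ (c − b) · (c − b) − + 158) ≡
    + 216 · (u ⊹ v ⊹ w) ⊹ + 166 − (+ 5 · a ⊹ b ⊹ c − + 14) · (+ 5 · a ⊹ b ⊹ c − + 14)
  eq = ℤ-Solver.solve-∀

-- Write b = j + 4k with j < 4; shifting by (20k, 4k, 4k) reduces to `near-base`, both sides
-- changing equally.
near : ∀ {a} b {c p q} → p < 25 → q < 9 →
  a ≡ + 5 · b ⊹ (+ p − + 20) → c ≡ b ⊹ (+ q − + 4) →
  bound (+ 5 · a ⊹ b ⊹ c) ≼ total a b c
near b {p = p} {q} p<25 q<9 refl refl = subst₂ _≼_ (sym bound≡) (sym total≡)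
  (ℤ.+-monoˡ-≤ _ (near-base p<25 q<9 (n%ℕd<d b 4)))
  where
  j k a₀ c₀ : ℤ
  j = + (b %ℕ 4)
  k = b /ℕ 4
  a₀ = + 5 · j ⊹ (+ p − + 20)
  c₀ = j ⊹ (+ q − + 4)
  b≡ : b ≡ j ⊹ + 4 · k
  b≡ = trans (a≡a%ℕn+[a/ℕn]*n b 4) (cong (j ⊹_) (ℤ.*-comm k (+ 4)))
  eq-a : ∀ j k p → + 5 · (j ⊹ + 4 · k) ⊹ (p − + 20) ≡ + 5 · j ⊹ (p − + 20) ⊹ + 20 · k
  eq-a = ℤ-Solver.solve-∀
  eq-c : ∀ j k q → (j ⊹ + 4 · k) ⊹ (q − + 4) ≡ j ⊹ (q − + 4) ⊹ + 4 · k
  eq-c = ℤ-Solver.solve-∀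
  a≡ : + 5 · b ⊹ (+ p − + 20) ≡ a₀ ⊹ + 20 · k
  a≡ = trans (cong (λ b → + 5 · b ⊹ (+ p − + 20)) b≡) (eq-a j k (+ p))
  c≡ : b ⊹ (+ q − + 4) ≡ c₀ ⊹ + 4 · k
  c≡ = trans (cong (_⊹ (+ q − + 4)) b≡) (eq-c j k (+ q))
  eq-n : ∀ a j c k → + 5 · (a ⊹ + 20 · k) ⊹ (j ⊹ + 4 · k) ⊹ (c ⊹ + 4 · k) ≡ + 5 · a ⊹ j ⊹ c ⊹ + 108 · k
  eq-n = ℤ-Solver.solve-∀
  bound≡ : bound (+ 5 · (+ 5 · b ⊹ (+ p − + 20)) ⊹ b ⊹ (b ⊹ (+ q − + 4))) ≡
    bound (+ 5 · a₀ ⊹ j ⊹ c₀) ⊹ (k · (+ 5 · a₀ ⊹ j ⊹ c₀ − + 14) ⊹ + 54 · k · k)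
  bound≡ = trans (cong bound (trans
    (cong₂ _⊹_ (cong₂ _⊹_ (cong (+ 5 ·_) a≡) b≡) c≡) (eq-n a₀ j c₀ k))) (bound-shift (+ 5 · a₀ ⊹ j ⊹ c₀) k)
  total≡ : total (+ 5 · b ⊹ (+ p − + 20)) b (b ⊹ (+ q − + 4)) ≡
    total a₀ j c₀ ⊹ (k · (+ 5 · a₀ ⊹ j ⊹ c₀ − + 14) ⊹ + 54 · k · k)
  total≡ = trans (cong₂ _⊹_ (cong₂ _⊹_ (cong quasi a≡) (cong quasi b≡)) (cong quasi c≡))
    (total-shift a₀ j c₀ k)

data Window (w : ℕ) (x : ℤ) : Set where
  below  : 0ℤ ≼ - + 1 − x → Window w x
  above  : 0ℤ ≼ x − + w → Window w x
  inside : ∀ i → i < w → x ≡ + i → Window w x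

window : ∀ w x → Window w x
window w -[1+ n ] = below (diff (ℤ.-≤- z≤n))
window w (+ i) with i <? w
... | yes i<w = inside i i<w refl
... | no i≮w  = above (diff (+≤+ (≮⇒≥ i≮w)))

spread : ℤ → ℤ → ℤ
spread p q = p · p ⊹ (p − + 5 · q) · (p − + 5 · q) ⊹ q · q

-- Here h = |p| - 13, and 13² = 169 already exceeds 158.
far-p : ∀ p q {h} → 0ℤ ≼ h → p · p ≡ (h ⊹ + 13) · (h ⊹ + 13) → + 158 ≼ spread p q
far-p p q {h} 0≤h p²≡ = by-certificate
  (0≤h ⊠ 0≤h ⊞ nonNeg {26} ⊠ 0≤h ⊞ nonNeg {11} ⊞ square-nonNeg (p − + 5 · q) ⊞ square-nonNeg q)
  (trans (eq h ((p − + 5 · q) · (p − + 5 · q)) (q · q))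
    (cong (λ v → v ⊹ (p − + 5 · q) · (p − + 5 · q) ⊹ q · q − + 158) (sym p²≡)))
  where
  eq : ∀ h u v → h · h ⊹ + 26 · h ⊹ + 11 ⊹ u ⊹ v ≡ (h ⊹ + 13) · (h ⊹ + 13) ⊹ u ⊹ v − + 158
  eq = ℤ-Solver.solve-∀

-- Completing the square, twice the spread is (2p - 5q)² + 27q². With h = |q| - 5, the second term
-- is at least 675 > 2 · 158.
far-q : ∀ p q {h} → 0ℤ ≼ h → q · q ≡ (h ⊹ + 5) · (h ⊹ + 5) → + 158 ≼ spread p q
far-q p q {h} 0≤h q²≡ = ℤ.*-cancelˡ-≤-pos (+ 158) (spread p q) (+ 2) (by-certificate
  (square-nonNeg (+ 2 · p − + 5 · q) ⊞ nonNeg {27} ⊠ (0≤h ⊠ 0≤h) ⊞ nonNeg {270} ⊠ 0≤h ⊞ nonNeg {359})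
  (begin
    r ⊹ + 27 · (h · h) ⊹ + 270 · h ⊹ + 359
      ≡⟨ eq₁ r h ⟩
    r ⊹ + 27 · ((h ⊹ + 5) · (h ⊹ + 5)) − + 2 · + 158
      ≡⟨ cong (λ v → r ⊹ + 27 · v − + 2 · + 158) q²≡ ⟨
    r ⊹ + 27 · (q · q) − + 2 · + 158
      ≡⟨ eq₂ p q ⟩
    + 2 · spread p q − + 2 · + 158 ∎))
  where
  open ≡-Reasoning
  r = (+ 2 · p − + 5 · q) · (+ 2 · p − + 5 · q)
  eq₁ : ∀ r h → r ⊹ + 27 · (h · h) ⊹ + 270 · h ⊹ + 359 ≡
    r ⊹ + 27 · ((h ⊹ + 5) · (h ⊹ + 5)) − + 2 · + 158
  eq₁ = ℤ-Solver.solve-∀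
  eq₂ : ∀ p q → (+ 2 · p − + 5 · q) · (+ 2 · p − + 5 · q) ⊹ + 27 · (q · q) − + 2 · + 158 ≡
    + 2 · (p · p ⊹ (p − + 5 · q) · (p − + 5 · q) ⊹ q · q) − + 2 · + 158
  eq₂ = ℤ-Solver.solve-∀

bound-≤-total : ∀ a b c → bound (+ 5 · a ⊹ b ⊹ c) ≼ total a b c
-- The offsets centre the windows: inside them p runs from -12 to 12 and q from -4 to 4.
bound-≤-total a b c = go (window 25 (a − + 5 · b ⊹ + 20)) (window 9 (c − b ⊹ + 4))
  where
  p q : ℤ
  p = a − + 5 · b ⊹ + 8
  q = c − b
  eq-a : ∀ a b → a ≡ + 5 · b ⊹ (a − + 5 · b ⊹ + 20 − + 20)
  eq-a = ℤ-Solver.solve-∀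
  eq-c : ∀ b c → c ≡ b ⊹ (c − b ⊹ + 4 − + 4)
  eq-c = ℤ-Solver.solve-∀
  eq₁ : ∀ u → (u ⊹ + 8) · (u ⊹ + 8) ≡ (- + 1 − (u ⊹ + 20) ⊹ + 13) · (- + 1 − (u ⊹ + 20) ⊹ + 13)
  eq₁ = ℤ-Solver.solve-∀
  eq₂ : ∀ u → (u ⊹ + 8) · (u ⊹ + 8) ≡ (u ⊹ + 20 − + 25 ⊹ + 13) · (u ⊹ + 20 − + 25 ⊹ + 13)
  eq₂ = ℤ-Solver.solve-∀
  eq₃ : ∀ q → q · q ≡ (- + 1 − (q ⊹ + 4) ⊹ + 5) · (- + 1 − (q ⊹ + 4) ⊹ + 5)
  eq₃ = ℤ-Solver.solve-∀
  eq₄ : ∀ q → q · q ≡ (q ⊹ + 4 − + 9 ⊹ + 5) · (q ⊹ + 4 − + 9 ⊹ + 5)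
  eq₄ = ℤ-Solver.solve-∀
  go : Window 25 (a − + 5 · b ⊹ + 20) → Window 9 (q ⊹ + 4) → bound (+ 5 · a ⊹ b ⊹ c) ≼ total a b c
  go (below h) _ = far a b c (far-p p q h (eq₁ (a − + 5 · b)))
  go (above h) _ = far a b c (far-p p q h (eq₂ (a − + 5 · b)))
  go (inside _ _ _) (below h) = far a b c (far-q p q h (eq₃ q))
  go (inside _ _ _) (above h) = far a b c (far-q p q h (eq₄ q))
  go (inside i i<25 i≡) (inside j j<9 j≡) =
    near b i<25 j<9
      (trans (eq-a a b) (cong (λ v → + 5 · b ⊹ (v − + 20)) i≡))
      (trans (eq-c b c) (cong (λ v → b ⊹ (v − + 4)) j≡))

-- Ranges of (s, t) away from the optimum

module _ (n : ℤ) {m : ℤ} (n≥29 : 0ℤ ≼ n − + 29) where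

  -- The term τ(s) alone suffices: s²/8 exceeds n²/200, while the target is about n²/216.
  bound-≤-n<5s : ∀ s → 0ℤ ≼ + 5 · s − + 1 − n → quasi s ≼ m → bound n ≼ m
  bound-≤-n<5s s n<5s m≥ = bound-≤ n (by-certificate
    (nonNeg {216} ⊠ diff m≥ ⊞ nonNeg {27} ⊠ diff (quasi-lower s)
      ⊞ n<5s ⊠ (nonNeg {2} ⊠ (n≥29 ⊞ nonNeg {15}) ⊞ n<5s)
      ⊞ nonNeg {2} ⊠ square-nonNeg (s − + 2) ⊞ nonNeg {10} ⊠ (n≥29 ⊞ nonNeg {20} ⊞ n<5s) ⊞ nonNeg {33})
    (eq s n m (quasi s)))
    where
    eq : ∀ s n m u →
      + 216 · (m − u) ⊹ + 27 · (+ 8 · u ⊹ + 4 − (s − + 2) · (s − + 2))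
        ⊹ (+ 5 · s − + 1 − n) · (+ 2 · (n − + 29 ⊹ + 15) ⊹ (+ 5 · s − + 1 − n))
        ⊹ + 2 · ((s − + 2) · (s − + 2)) ⊹ + 10 · (n − + 29 ⊹ + 20 ⊹ (+ 5 · s − + 1 − n)) ⊹ + 33 ≡
      + 216 · m ⊹ + 166 − (n − + 14) · (n − + 14)
    eq = ℤ-Solver.solve-∀

  -- By Cauchy-Schwarz (4s + c)² ≤ 17(s² + c²), so τ(s) + τ(c) is about n²/136 or more.
  bound-≤-n<4s+c : ∀ s c → 0ℤ ≼ + 4 · s ⊹ c − + 1 − n → quasi s ⊹ quasi c ≼ m → bound n ≼ m
  bound-≤-n<4s+c s c n<4s+c m≥ = bound-≤ n (by-certificate
    (nonNeg {216} ⊠ diff m≥ ⊞ nonNeg {27} ⊠ (diff (quasi-lower s) ⊞ diff (quasi-lower c))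
      ⊞ square-nonNeg ((s − + 2) − + 4 · (c − + 2))
      ⊞ nonNeg {10} ⊠ (square-nonNeg (s − + 2) ⊞ square-nonNeg (c − + 2))
      ⊞ n<4s+c ⊠ (n<4s+c ⊞ nonNeg {2} ⊠ (n≥29 ⊞ nonNeg {20})) ⊞ nonNeg {10} ⊠ n≥29 ⊞ nonNeg {125})
    (eq s c n m (quasi s) (quasi c)))
    where
    eq : ∀ s c n m u v →
      + 216 · (m − (u ⊹ v))
        ⊹ + 27 · ((+ 8 · u ⊹ + 4 − (s − + 2) · (s − + 2)) ⊹ (+ 8 · v ⊹ + 4 − (c − + 2) · (c − + 2)))
        ⊹ ((s − + 2) − + 4 · (c − + 2)) · ((s − + 2) − + 4 · (c − + 2))
        ⊹ + 10 · ((s − + 2) · (s − + 2) ⊹ (c − + 2) · (c − + 2))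
        ⊹ (+ 4 · s ⊹ c − + 1 − n) · ((+ 4 · s ⊹ c − + 1 − n) ⊹ + 2 · (n − + 29 ⊹ + 20))
        ⊹ + 10 · (n − + 29) ⊹ + 125 ≡
      + 216 · m ⊹ + 166 − (n − + 14) · (n − + 14)
    eq = ℤ-Solver.solve-∀

  module _ (s h : ℤ) (s≥1 : 0ℤ ≼ s − + 1) where

    private
      s≥0 : 0ℤ ≼ s
      s≥0 = ℤ.≤-trans (+≤+ z≤n) (ℤ.0≤i-j⇒j≤i s≥1)

      -- From 29 on, both arguments lie beyond the vertex 14, so n may be enlarged to x.
      square-mono : ∀ x → 0ℤ ≼ x − n → (n − + 14) · (n − + 14) ≼ (x − + 14) · (x − + 14)
      square-mono x n≤x = by-certificate
        (n≤x ⊠ (n≤x ⊞ nonNeg {2} ⊠ n≥29 ⊞ nonNeg {30})) (eq x n)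
        where
        eq : ∀ x n → (x − n) · ((x − n) ⊹ + 2 · (n − + 29) ⊹ + 30) ≡
          (x − + 14) · (x − + 14) − (n − + 14) · (n − + 14)
        eq = ℤ-Solver.solve-∀

    -- For fixed s and b the excess is a concave function of c, so it is bounded by its values at the
    -- two ends c = 4s + 5 and c = 20s + 4b of the range.
    bound-≤-n≤5t : ∀ b c → 0ℤ ≼ b → 0ℤ ≼ c − + 4 · s − + 5 → 0ℤ ≼ + 20 · s ⊹ + 4 · b − c →
      0ℤ ≼ + 5 · s ⊹ b ⊹ c − n → 0ℤ ≼ h ⊹ + 2 · (s · (+ 1 ⊹ s)) − s · c →
      quasi s ⊹ quasi b ⊹ h ≼ m → bound n ≼ m
    bound-≤-n≤5t b c b≥0 c≥ c≤ n≤ h≥ m≥ = bound-≤ n (ℤ.≤-trans (square-mono (+ 5 · s ⊹ b ⊹ c) n≤)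
      (by-cases (ℤ.≤-total 0ℤ (+ 191 · s ⊹ + 14 − + 5 · b))))
      where
      x≥14 : 0ℤ ≼ + 5 · s ⊹ b ⊹ c − + 14
      x≥14 = subst (0ℤ ≼_) (eq s b c) (nonNeg {9} ⊠ s≥1 ⊞ b≥0 ⊞ c≥)
        where
        eq : ∀ s b c → + 9 · (s − + 1) ⊹ b ⊹ (c − + 4 · s − + 5) ≡ + 5 · s ⊹ b ⊹ c − + 14
        eq = ℤ-Solver.solve-∀
      common : 0ℤ ≼ + 216 · (m − (quasi s ⊹ quasi b ⊹ h))
        ⊹ + 27 · ((+ 8 · quasi s ⊹ + 4 − (s − + 2) · (s − + 2)) ⊹ (+ 8 · quasi b ⊹ + 4 − (b − + 2) · (b − + 2)))
        ⊹ + 216 · (h ⊹ + 2 · (s · (+ 1 ⊹ s)) − s · c)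
        ⊹ (+ 5 · s ⊹ b ⊹ c − + 14) · (+ 20 · s ⊹ + 4 · b − c)
      common = nonNeg {216} ⊠ diff m≥ ⊞ nonNeg {27} ⊠ (diff (quasi-lower s) ⊞ diff (quasi-lower b))
        ⊞ nonNeg {216} ⊠ h≥ ⊞ x≥14 ⊠ c≤
      eq₁ : ∀ s b c m u v h →
        + 216 · (m − (u ⊹ v ⊹ h))
          ⊹ + 27 · ((+ 8 · u ⊹ + 4 − (s − + 2) · (s − + 2)) ⊹ (+ 8 · v ⊹ + 4 − (b − + 2) · (b − + 2)))
          ⊹ + 216 · (h ⊹ + 2 · (s · (+ 1 ⊹ s)) − s · c)
          ⊹ (+ 5 · s ⊹ b ⊹ c − + 14) · (+ 20 · s ⊹ + 4 · b − c)
        ⊹ ((+ 191 · s ⊹ + 14 − + 5 · b) · (c − + 4 · s − + 5)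
          ⊹ (+ 3 · b − + 11 · s − + 8) · (+ 3 · b − + 11 · s − + 8) ⊹ (+ 2 · b − s) · (+ 2 · b − s)
          ⊹ + 8 · (b · b) ⊹ (b − + 1) · (b − + 1) ⊹ b
          ⊹ + 112 · (s · s) ⊹ + 715 · (s − + 1) ⊹ + 690) ≡
        + 216 · m ⊹ + 166 − (+ 5 · s ⊹ b ⊹ c − + 14) · (+ 5 · s ⊹ b ⊹ c − + 14)
      eq₁ = ℤ-Solver.solve-∀
      eq₂ : ∀ s b c m u v h →
        + 216 · (m − (u ⊹ v ⊹ h))
          ⊹ + 27 · ((+ 8 · u ⊹ + 4 − (s − + 2) · (s − + 2)) ⊹ (+ 8 · v ⊹ + 4 − (b − + 2) · (b − + 2)))
          ⊹ + 216 · (h ⊹ + 2 · (s · (+ 1 ⊹ s)) − s · c)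
          ⊹ (+ 5 · s ⊹ b ⊹ c − + 14) · (+ 20 · s ⊹ + 4 · b − c)
        ⊹ ((+ 20 · s ⊹ + 4 · b − c) · (+ 0 − (+ 191 · s ⊹ + 14 − + 5 · b))
          ⊹ + 3290 · (s · s) ⊹ + 2 · (b · b) ⊹ + 614 · (s · b) ⊹ + 160 · (s − + 1) ⊹ + 32 · b ⊹ + 130) ≡
        + 216 · m ⊹ + 166 − (+ 5 · s ⊹ b ⊹ c − + 14) · (+ 5 · s ⊹ b ⊹ c − + 14)
      eq₂ = ℤ-Solver.solve-∀
      -- Once `common` has absorbed the c² term, the rest is linear in c with slope 191s + 14 - 5b;
      -- its sign tells at which end of the range to expand.
      by-cases : 0ℤ ≼ + 191 · s ⊹ + 14 − + 5 · b ⊎ + 191 · s ⊹ + 14 − + 5 · b ≼ 0ℤ →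
        (+ 5 · s ⊹ b ⊹ c − + 14) · (+ 5 · s ⊹ b ⊹ c − + 14) ≼ + 216 · m ⊹ + 166
      by-cases (inj₁ p) = by-certificate
        (common ⊞ (p ⊠ c≥ ⊞ square-nonNeg (+ 3 · b − + 11 · s − + 8) ⊞ square-nonNeg (+ 2 · b − s)
          ⊞ nonNeg {8} ⊠ square-nonNeg b ⊞ square-nonNeg (b − + 1) ⊞ b≥0
          ⊞ nonNeg {112} ⊠ square-nonNeg s ⊞ nonNeg {715} ⊠ s≥1 ⊞ nonNeg {690}))
        (eq₁ s b c m (quasi s) (quasi b) h)
      by-cases (inj₂ p) = by-certificate
        (common ⊞ (c≤ ⊠ diff p ⊞ nonNeg {3290} ⊠ square-nonNeg s ⊞ nonNeg {2} ⊠ square-nonNeg b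
          ⊞ nonNeg {614} ⊠ (s≥0 ⊠ b≥0) ⊞ nonNeg {160} ⊠ s≥1 ⊞ nonNeg {32} ⊠ b≥0 ⊞ nonNeg {130}))
        (eq₂ s b c m (quasi s) (quasi b) h)

    -- The leading part 4st of the bound on h, weighted by 216, dominates 25t² because t ≤ 5s, and s
    -- ≤ t pays for the negative s² terms; τ(w) covers w².
    bound-≤-n>5t : ∀ t w → 0ℤ ≼ t − s → 0ℤ ≼ + 5 · s − t → 0ℤ ≼ w − + 2 → n ≡ + 5 · t ⊹ w − s →
      0ℤ ≼ h ⊹ + 2 · (s · (+ 1 ⊹ s)) − s · (+ 4 · t ⊹ w − s) →
      quasi s ⊹ h ⊹ quasi w ≼ m → bound n ≼ m
    bound-≤-n>5t t w s≤t t≤5s w≥2 n≡ h≥ m≥ = bound-≤ n (subst (λ x → (x − + 14) · (x − + 14) ≼ + 216 · m ⊹ + 166)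
      (sym n≡) (by-certificate
        (nonNeg {216} ⊠ diff m≥ ⊞ nonNeg {27} ⊠ (diff (quasi-lower s) ⊞ diff (quasi-lower w)) ⊞ nonNeg {216} ⊠ h≥
          ⊞ nonNeg {26} ⊠ square-nonNeg (w − + 2)
          ⊞ w≥2 ⊠ (nonNeg {10} ⊠ t≤5s ⊞ nonNeg {168} ⊠ s≥0 ⊞ nonNeg {24})
          ⊞ nonNeg {25} ⊠ (t≥0 ⊠ t≤5s) ⊞ (nonNeg {749} ⊠ s≥0 ⊞ nonNeg {120}) ⊠ s≤t
          ⊞ nonNeg {29} ⊞ nonNeg {242} ⊠ s≥1 ⊞ nonNeg {127} ⊠ square-nonNeg (s − + 1))
        (eq s t w m (quasi s) (quasi w) h)))
      where
      t≥0 : 0ℤ ≼ t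
      t≥0 = ℤ.≤-trans s≥0 (ℤ.0≤i-j⇒j≤i s≤t)
      eq : ∀ s t w m u v h →
        + 216 · (m − (u ⊹ h ⊹ v))
          ⊹ + 27 · ((+ 8 · u ⊹ + 4 − (s − + 2) · (s − + 2)) ⊹ (+ 8 · v ⊹ + 4 − (w − + 2) · (w − + 2)))
          ⊹ + 216 · (h ⊹ + 2 · (s · (+ 1 ⊹ s)) − s · (+ 4 · t ⊹ w − s))
          ⊹ + 26 · ((w − + 2) · (w − + 2))
          ⊹ (w − + 2) · (+ 10 · (+ 5 · s − t) ⊹ + 168 · s ⊹ + 24)
          ⊹ + 25 · (t · (+ 5 · s − t)) ⊹ (+ 749 · s ⊹ + 120) · (t − s)
          ⊹ + 29 ⊹ + 242 · (s − + 1) ⊹ + 127 · ((s − + 1) · (s − + 1)) ≡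
        + 216 · m ⊹ + 166 − (+ 5 · t ⊹ w − s − + 14) · (+ 5 · t ⊹ w − s − + 14)
      eq = ℤ-Solver.solve-∀

    -- With B = b - 2 and W = w - 2, 27(B² + W²) = (5B + W)² + (B - 5W)² + B² + W², which matches
    -- the part 5b + w of n; the bound on h covers the terms in s.
    bound-≤-n>5t-5s≤t : ∀ b w → 0ℤ ≼ b → 0ℤ ≼ w − + 2 → n ≡ + 24 · s ⊹ + 5 · b ⊹ w →
      0ℤ ≼ h ⊹ + 2 · (s · (+ 1 ⊹ s)) − s · (+ 19 · s ⊹ + 4 · b ⊹ w) →
      quasi s ⊹ h ⊹ quasi b ⊹ quasi w ≼ m → bound n ≼ m
    bound-≤-n>5t-5s≤t b w b≥0 w≥2 n≡ h≥ m≥ = bound-≤ n (subst (λ x → (x − + 14) · (x − + 14) ≼ + 216 · m ⊹ + 166)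
      (sym n≡) (by-certificate
        (nonNeg {216} ⊠ diff m≥
          ⊞ nonNeg {27} ⊠ (diff (quasi-lower s) ⊞ diff (quasi-lower b) ⊞ diff (quasi-lower w)) ⊞ nonNeg {216} ⊠ h≥
          ⊞ square-nonNeg (b − + 2 − + 5 · (w − + 2)) ⊞ square-nonNeg (w − + 2) ⊞ square-nonNeg (b − + 2)
          ⊞ nonNeg {624} ⊠ (b≥0 ⊠ s≥0) ⊞ nonNeg {20} ⊠ b≥0 ⊞ nonNeg {168} ⊠ (w≥2 ⊠ s≥0) ⊞ nonNeg {4} ⊠ w≥2
          ⊞ nonNeg {3123} ⊠ square-nonNeg s ⊞ nonNeg {468} ⊠ s≥1 ⊞ nonNeg {374})
        (eq s b w m (quasi s) (quasi b) (quasi w) h)))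
      where
      eq : ∀ s b w m u v x h →
        + 216 · (m − (u ⊹ h ⊹ v ⊹ x))
          ⊹ + 27 · ((+ 8 · u ⊹ + 4 − (s − + 2) · (s − + 2)) ⊹ (+ 8 · v ⊹ + 4 − (b − + 2) · (b − + 2))
            ⊹ (+ 8 · x ⊹ + 4 − (w − + 2) · (w − + 2)))
          ⊹ + 216 · (h ⊹ + 2 · (s · (+ 1 ⊹ s)) − s · (+ 19 · s ⊹ + 4 · b ⊹ w))
          ⊹ (b − + 2 − + 5 · (w − + 2)) · (b − + 2 − + 5 · (w − + 2))
          ⊹ (w − + 2) · (w − + 2) ⊹ (b − + 2) · (b − + 2)
          ⊹ + 624 · (b · s) ⊹ + 20 · b ⊹ + 168 · ((w − + 2) · s) ⊹ + 4 · (w − + 2)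
          ⊹ + 3123 · (s · s) ⊹ + 468 · (s − + 1) ⊹ + 374 ≡
        + 216 · m ⊹ + 166 − (+ 24 · s ⊹ + 5 · b ⊹ w − + 14) · (+ 24 · s ⊹ + 5 · b ⊹ w − + 14)
      eq = ℤ-Solver.solve-∀

-- Lower bound for every coloring

lift : ∀ {m n e} → m ≤ n → + n − + m ≡ e → 0ℤ ≼ e
lift m≤n eq = subst (0ℤ ≼_) eq (diff (+≤+ m≤n))

bound-≤-of-total : ∀ {n m} a b c → n ≡ + 5 · a ⊹ b ⊹ c → total a b c ≼ m → bound n ≼ m
bound-≤-of-total a b c refl h = ℤ.≤-trans (bound-≤-total a b c) h

total-tri : ∀ a b c → total (+ a) (+ b) (+ c) ≡ + (tri a + tri b + tri c)
total-tri a b c = cong₂ _⊹_ (cong₂ _⊹_ (quasi-tri a) (quasi-tri b)) (quasi-tri c)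

module _ (s g c : ℕ) (s≥1 : 1 ≤ s) (n≥29 : 29 ≤ s + g + c) where

  private
    t n b d w h M : ℕ
    t = s + g
    n = t + c
    b = g ∸ 4 * s
    d = 4 * s ∸ g
    w = c + s ∸ 4 * t
    h = ∑ s (λ y → c ∸ 4 * y)
    M = M4 n s t

    n≥29′ : 0ℤ ≼ + n − + 29
    n≥29′ = diff (+≤+ n≥29)

    s≥1′ : 0ℤ ≼ + s − + 1
    s≥1′ = diff (+≤+ s≥1)

    h≥ : 0ℤ ≼ + h ⊹ + 2 · (+ s · (+ 1 ⊹ + s)) − + s · + c
    h≥ = lift (∑-linear-≤ s c) (cong₂ (λ u v → + h ⊹ u − v)
      (trans (ℤ.pos-* 2 (s * suc s)) (cong (+ 2 ·_) (ℤ.pos-* s (suc s)))) (ℤ.pos-* s c))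

    M-lower : ∀ {x k y} → x ≤ crossing s g c → k ≤ h → y ≤ high-y s g c → tri s + x + k + tri b + y ≤ M
    M-lower = M4-lower s g c

    tri-c≤h : c ≤ 4 * s + 4 → tri c ≤ h
    tri-c≤h c≤ = ≤-reflexive (sym (∑-tri s c c≤))

    b≡ : 4 * s ≤ g → + g ≡ + 4 · + s ⊹ + b
    b≡ 4s≤g = trans (cong +_ (sym (m+[n∸m]≡n 4s≤g))) (cong (_⊹ + b) (ℤ.pos-* 4 s))

    d≡ : g ≤ 4 * s → g + d ≡ 4 * s
    d≡ = m+[n∸m]≡n

    d≡′ : g ≤ 4 * s → + d ≡ + 4 · + s − + g
    d≡′ g≤4s = trans (eq (+ d) (+ g)) (cong (_− + g) (trans (cong +_ (d≡ g≤4s)) (ℤ.pos-* 4 s)))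
      where
      eq : ∀ d g → d ≡ g ⊹ d − g
      eq = ℤ-Solver.solve-∀

    Goal : Set
    Goal = bound (+ n) ≼ + M

    main : c ≤ 4 * s + 4 → 4 * s ≤ g → Goal
    main c≤ 4s≤g = bound-≤-of-total (+ s) (+ b) (+ c)
      (trans (cong (λ v → + s ⊹ v ⊹ + c) (b≡ 4s≤g)) (eq (+ s) (+ b) (+ c)))
      (subst (_≼ + M) (sym (total-tri s b c)) (+≤+ (≤-trans (≤-reflexive (eq′ (tri s) (tri b) (tri c)))
        (M-lower z≤n (tri-c≤h c≤) z≤n))))
      where
      eq : ∀ s b c → s ⊹ (+ 4 · s ⊹ b) ⊹ c ≡ + 5 · s ⊹ b ⊹ c
      eq = ℤ-Solver.solve-∀
      eq′ : ∀ s b c → s + b + c ≡ s + 0 + c + b + 0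
      eq′ = solve-∀

    reflected : c ≤ 4 * s + 4 → g ≤ 4 * s → d ≤ c → d ≤ s → Goal
    reflected c≤ g≤4s d≤c d≤s = bound-≤-of-total (+ s) (- + d) (+ c)
      (trans (eq (+ s) (+ g) (+ c)) (cong (λ v → + 5 · + s ⊹ - v ⊹ + c) (sym (d≡′ g≤4s))))
      (subst (_≼ + M) (sym total≡) (+≤+ (≤-trans (drop (tri s) (tri (4 + d)) (tri c) (tri b))
        (M-lower (crossing-lower s g c (d≡ g≤4s) d≤s d≤c) (tri-c≤h c≤) z≤n))))
      where
      eq : ∀ s g c → s ⊹ g ⊹ c ≡ + 5 · s ⊹ - (+ 4 · s − g) ⊹ c
      eq = ℤ-Solver.solve-∀
      total≡ : total (+ s) (- + d) (+ c) ≡ + (tri s + tri (4 + d) + tri c)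
      total≡ = cong₂ _⊹_ (cong₂ _⊹_ (quasi-tri s)
        (trans (quasi-reflect (+ d)) (quasi-tri (4 + d)))) (quasi-tri c)
      drop : ∀ a x k y → a + x + k ≤ a + x + k + y + 0
      drop a x k y = ≤-trans (m≤m+n (a + x + k) y) (m≤m+n _ 0)

    -- As n = 5s - d + c, the condition c < d means n < 5s.
    long-low : g ≤ 4 * s → c < d → Goal
    long-low g≤4s c<d = bound-≤-n<5s (+ n) n≥29′ (+ s)
      (lift c<d (trans (cong (_− (+ 1 ⊹ + c)) (d≡′ g≤4s)) (eq (+ s) (+ g) (+ c))))
      (subst (_≼ + M) (sym (quasi-tri s)) (+≤+ (≤-trans (drop (tri s) (tri b)) (M-lower z≤n z≤n z≤n))))
      where
      eq : ∀ s g c → + 4 · s − g − (+ 1 ⊹ c) ≡ + 5 · s − + 1 − (s ⊹ g ⊹ c)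
      eq = ℤ-Solver.solve-∀
      drop : ∀ a y → a ≤ a + 0 + 0 + y + 0
      drop a y = ≤-trans (m≤m+n a y) (≤-reflexive (eq′ a y))
        where
        eq′ : ∀ a y → a + y ≡ a + 0 + 0 + y + 0
        eq′ = solve-∀

    -- Likewise s < d means n < 4s + c, that is t < 4s.
    short-mid : c ≤ 4 * s + 4 → g ≤ 4 * s → s < d → Goal
    short-mid c≤ g≤4s s<d = bound-≤-n<4s+c (+ n) n≥29′ (+ s) (+ c)
      (lift s<d (trans (cong (_− (+ 1 ⊹ + s)) (d≡′ g≤4s)) (eq (+ s) (+ g) (+ c))))
      (subst (_≼ + M) (sym (cong₂ _⊹_ (quasi-tri s) (quasi-tri c)))
        (+≤+ (≤-trans (drop (tri s) (tri c) (tri b)) (M-lower z≤n (tri-c≤h c≤) z≤n))))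
      where
      eq : ∀ s g c → + 4 · s − g − (+ 1 ⊹ s) ≡ + 4 · s ⊹ c − + 1 − (s ⊹ g ⊹ c)
      eq = ℤ-Solver.solve-∀
      drop : ∀ a k y → a + k ≤ a + 0 + k + y + 0
      drop a k y = ≤-trans (m≤m+n (a + k) y) (≤-reflexive (eq′ a k y))
        where
        eq′ : ∀ a k y → a + k + y ≡ a + 0 + k + y + 0
        eq′ = solve-∀

    long-high : 4 * s + 4 < c → c ≤ 4 * t → Goal
    long-high c> c≤4t = bound-≤-n≤5t (+ n) n≥29′ (+ s) (+ h) s≥1′ (+ b) (+ c) nonNeg
      (lift c> (trans (cong (λ v → + c − (+ 1 ⊹ (v ⊹ + 4))) (ℤ.pos-* 4 s)) (eq₁ (+ s) (+ c))))
      (lift c≤ (trans (cong₂ (λ u v → u ⊹ v − + c) (ℤ.pos-* 20 s) (ℤ.pos-* 4 b)) refl))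
      (lift n≤ (cong (λ u → u ⊹ + b ⊹ + c − + n) (ℤ.pos-* 5 s)))
      h≥
      (subst (_≼ + M) (sym (cong₂ (λ u v → u ⊹ v ⊹ + h) (quasi-tri s) (quasi-tri b)))
        (+≤+ (≤-trans (≤-reflexive (eq₂ (tri s) (tri b) h)) (M-lower z≤n ≤-refl z≤n))))
      where
      -- Only an inequality: if g < 4s, the truncated `b` is 0.
      g≤ : g ≤ 4 * s + b
      g≤ = m≤n+m∸n g (4 * s)
      c≤ : c ≤ 20 * s + 4 * b
      c≤ = ≤-trans c≤4t (≤-trans (*-monoʳ-≤ 4 (+-monoʳ-≤ s g≤)) (≤-reflexive (eq s b)))
        where
        eq : ∀ s b → 4 * (s + (4 * s + b)) ≡ 20 * s + 4 * b
        eq = solve-∀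
      n≤ : n ≤ 5 * s + b + c
      n≤ = ≤-trans (+-monoˡ-≤ c (+-monoʳ-≤ s g≤)) (≤-reflexive (eq s b c))
        where
        eq : ∀ s b c → s + (4 * s + b) + c ≡ 5 * s + b + c
        eq = solve-∀
      eq₁ : ∀ s c → c − (+ 1 ⊹ (+ 4 · s ⊹ + 4)) ≡ c − + 4 · s − + 5
      eq₁ = ℤ-Solver.solve-∀
      eq₂ : ∀ a y h → a + y + h ≡ a + 0 + h + y + 0
      eq₂ = solve-∀

    module _ (4t<c : 4 * t < c) where

      c≡ : + c ≡ + 4 · + t ⊹ + w − + s
      c≡ = trans (eq (+ c) (+ s)) (cong (_− + s) (trans (cong +_ (sym (m+[n∸m]≡n 4t≤c+s)))
        (cong (_⊹ + w) (ℤ.pos-* 4 t))))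
        where
        4t≤c+s : 4 * t ≤ c + s
        4t≤c+s = ≤-trans (<⇒≤ 4t<c) (m≤m+n c s)
        eq : ∀ c s → c ≡ c ⊹ s − s
        eq = ℤ-Solver.solve-∀

      -- From c ≥ 4t + 1 and s ≥ 1.
      w≥2 : 0ℤ ≼ + w − + 2
      w≥2 = diff (+≤+ (m+n≤o⇒m≤o∸n 2 (≤-trans (≤-reflexive (+-comm 1 (suc (4 * t)))) (+-mono-≤ 4t<c s≥1))))

      h≥′ : ∀ {x} → + c ≡ x → 0ℤ ≼ + h ⊹ + 2 · (+ s · (+ 1 ⊹ + s)) − + s · x
      h≥′ c≡x = subst (λ x → 0ℤ ≼ + h ⊹ + 2 · (+ s · (+ 1 ⊹ + s)) − + s · x) c≡x h≥

      M≥ : tri s + 0 + h + tri b + tri w ≤ M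
      M≥ = M-lower z≤n ≤-refl (high-y-lower s g c)

      very-long-high-5s≤t : 4 * s ≤ g → Goal
      very-long-high-5s≤t 4s≤g = bound-≤-n>5t-5s≤t (+ n) n≥29′ (+ s) (+ h) s≥1′ (+ b) (+ w) nonNeg w≥2
        (trans (cong₂ (λ u v → + s ⊹ u ⊹ v) (b≡ 4s≤g) c≡′) (eq₁ (+ s) (+ b) (+ w)))
        (h≥′ c≡′)
        (subst (_≼ + M) (sym (cong₂ _⊹_ (cong₂ _⊹_ (cong (_⊹ + h) (quasi-tri s)) (quasi-tri b)) (quasi-tri w)))
          (+≤+ (≤-trans (≤-reflexive (eq₂ (tri s) h (tri b) (tri w))) M≥)))
        where
        eq₀ : ∀ s b w → + 4 · (s ⊹ (+ 4 · s ⊹ b)) ⊹ w − s ≡ + 19 · s ⊹ + 4 · b ⊹ w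
        eq₀ = ℤ-Solver.solve-∀
        c≡′ : + c ≡ + 19 · + s ⊹ + 4 · + b ⊹ + w
        c≡′ = trans c≡ (trans (cong (λ u → + 4 · (+ s ⊹ u) ⊹ + w − + s) (b≡ 4s≤g)) (eq₀ (+ s) (+ b) (+ w)))
        eq₁ : ∀ s b w → s ⊹ (+ 4 · s ⊹ b) ⊹ (+ 19 · s ⊹ + 4 · b ⊹ w) ≡ + 24 · s ⊹ + 5 · b ⊹ w
        eq₁ = ℤ-Solver.solve-∀
        eq₂ : ∀ a h y w → a + h + y + w ≡ a + 0 + h + y + w
        eq₂ = solve-∀

      very-long-high-t≤5s : g ≤ 4 * s → Goal
      very-long-high-t≤5s g≤4s = bound-≤-n>5t (+ n) n≥29′ (+ s) (+ h) s≥1′ (+ t) (+ w)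
        (lift (m≤m+n s g) refl)
        (lift g≤4s (trans (cong (_− + g) (ℤ.pos-* 4 s)) (eq₀ (+ s) (+ g))))
        w≥2
        (trans (cong (+ t ⊹_) c≡) (eq₁ (+ s) (+ t) (+ w)))
        (h≥′ c≡)
        (subst (_≼ + M) (sym (cong₂ _⊹_ (cong (_⊹ + h) (quasi-tri s)) (quasi-tri w)))
          (+≤+ (≤-trans (+-monoˡ-≤ (tri w) (drop (tri s) h (tri b))) M≥)))
        where
        eq₀ : ∀ s g → + 4 · s − g ≡ + 5 · s − (s ⊹ g)
        eq₀ = ℤ-Solver.solve-∀
        eq₁ : ∀ s t w → t ⊹ (+ 4 · t ⊹ w − s) ≡ + 5 · t ⊹ w − s
        eq₁ = ℤ-Solver.solve-∀
        drop : ∀ a h y → a + h ≤ a + 0 + h + y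
        drop a h y = ≤-trans (≤-reflexive (cong (_+ h) (sym (+-identityʳ a)))) (m≤m+n (a + 0 + h) y)

  -- The reflected total needs both d ≤ c and d ≤ s, so that the crossing triples contain a whole
  -- triangle; if either fails, a bound ignoring them is strong enough.
  bound-≤-M4 : bound (+ (s + g + c)) ≼ + M4 (s + g + c) s (s + g)
  bound-≤-M4 = by-c (≤-<-connex c (4 * s + 4))
    where
    by-d : c ≤ 4 * s + 4 → g ≤ 4 * s → d ≤ c ⊎ c < d → d ≤ s ⊎ s < d → Goal
    by-d c≤ g≤4s (inj₁ d≤c) (inj₁ d≤s) = reflected c≤ g≤4s d≤c d≤s
    by-d c≤ g≤4s (inj₁ d≤c) (inj₂ s<d) = short-mid c≤ g≤4s s<d
    by-d c≤ g≤4s (inj₂ c<d) _          = long-low g≤4s c<d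
    by-g : c ≤ 4 * s + 4 → 4 * s ≤ g ⊎ g ≤ 4 * s → Goal
    by-g c≤ (inj₁ 4s≤g) = main c≤ 4s≤g
    by-g c≤ (inj₂ g≤4s) = by-d c≤ g≤4s (≤-<-connex d c) (≤-<-connex d s)
    by-g′ : 4 * t < c → 4 * s ≤ g ⊎ g ≤ 4 * s → Goal
    by-g′ 4t<c (inj₁ 4s≤g) = very-long-high-5s≤t 4t<c 4s≤g
    by-g′ 4t<c (inj₂ g≤4s) = very-long-high-t≤5s 4t<c g≤4s
    by-t : 4 * s + 4 < c → c ≤ 4 * t ⊎ 4 * t < c → Goal
    by-t c> (inj₁ c≤4t) = long-high c> c≤4t
    by-t c> (inj₂ 4t<c) = by-g′ 4t<c (≤-total (4 * s) g)
    by-c : c ≤ 4 * s + 4 ⊎ 4 * s + 4 < c → Goal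
    by-c (inj₁ c≤) = by-g c≤ (≤-total (4 * s) g)
    by-c (inj₂ c>) = by-t c> (≤-<-connex c (4 * t))

-- Attaining the bound

-- In the coordinates b = t - 5s and c = n - t these conditions suffice for `M4-exact`, and they
-- survive the shift by a period.
Optimal : ℕ → ℕ → ℕ → ℕ → Set
Optimal n s b c = 1 ≤ s × 5 * s + b + c ≡ n × c ≤ 4 * s + 4 × total (+ s) (+ b) (+ c) ≡ bound (+ n)

optimal? : ∀ n s b c → Dec (Optimal n s b c)
optimal? n s b c = 1 ≤? s ×-dec 5 * s + b + c ≟ n ×-dec c ≤? 4 * s + 4 ×-dec
  total (+ s) (+ b) (+ c) ℤ.≟ bound (+ n)

optimal-shift : ∀ {n s b c} k → Optimal n s b c →
  Optimal (n + 108 * k) (s + 20 * k) (b + 4 * k) (c + 4 * k)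
optimal-shift {n} {s} {b} {c} k (s≥1 , refl , c≤ , total≡) =
  ≤-trans s≥1 (m≤m+n s (20 * k)) , eq₁ s b c k ,
  -- 4k ≤ 80k, where 80 = 4 · 20 is the growth of 4s and 76 = 80 - 4.
  ≤-trans (+-mono-≤ c≤ (*-monoˡ-≤ k (m≤n+m 4 76))) (≤-reflexive (eq₂ s k)) , total≡′
  where
  eq₁ : ∀ s b c k → 5 * (s + 20 * k) + (b + 4 * k) + (c + 4 * k) ≡ 5 * s + b + c + 108 * k
  eq₁ = solve-∀
  eq₂ : ∀ s k → 4 * s + 4 + 80 * k ≡ 4 * (s + 20 * k) + 4
  eq₂ = solve-∀
  pos : ∀ m i → + (m + i * k) ≡ + m ⊹ + i · + k
  pos m i = cong (+ m ⊹_) (ℤ.pos-* i k)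
  n≡ : + 5 · + s ⊹ + b ⊹ + c ≡ + n
  n≡ = cong (λ v → v ⊹ + b ⊹ + c) (sym (ℤ.pos-* 5 s))
  total≡′ : total (+ (s + 20 * k)) (+ (b + 4 * k)) (+ (c + 4 * k)) ≡ bound (+ (n + 108 * k))
  total≡′ = begin
    total (+ (s + 20 * k)) (+ (b + 4 * k)) (+ (c + 4 * k))
      ≡⟨ cong₂ _⊹_ (cong₂ _⊹_ (cong quasi (pos s 20)) (cong quasi (pos b 4))) (cong quasi (pos c 4)) ⟩
    total (+ s ⊹ + 20 · + k) (+ b ⊹ + 4 · + k) (+ c ⊹ + 4 · + k)
      ≡⟨ total-shift (+ s) (+ b) (+ c) (+ k) ⟩
    total (+ s) (+ b) (+ c) ⊹ (+ k · (+ 5 · + s ⊹ + b ⊹ + c − + 14) ⊹ + 54 · + k · + k)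
      ≡⟨ cong₂ (λ u v → u ⊹ (+ k · (v − + 14) ⊹ + 54 · + k · + k)) total≡ n≡ ⟩
    bound (+ n) ⊹ (+ k · (+ n − + 14) ⊹ + 54 · + k · + k)
      ≡⟨ bound-shift (+ n) (+ k) ⟨
    bound (+ n ⊹ + 108 · + k)
      ≡⟨ cong bound (pos n 108) ⟨
    bound (+ (n + 108 * k)) ∎
    where open ≡-Reasoning

-- The continuous optimum is s = 5n/27 and c = n/27.
optimal-base : ∀ {i} → i < 108 → ∃ λ u → u < 2 × ∃ λ v → v < 4 ×
  let n = 29 + i; s = 5 * n / 27 ∸ u; c = n / 27 + v in Optimal n s (n ∸ (5 * s + c)) c
optimal-base = toWitness {a? = allUpTo? (λ i → anyUpTo? (λ u → anyUpTo? (λ v →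
  let n = 29 + i; s = 5 * n / 27 ∸ u; c = n / 27 + v in optimal? n s (n ∸ (5 * s + c)) c) 4) 2) 108} _

optimal-exists : ∀ n → 29 ≤ n → ∃ λ s → ∃ λ b → ∃ λ c → Optimal n s b c
optimal-exists n n≥29 = from-base (optimal-base (m%n<n (n ∸ 29) 108))
  where
  i k : ℕ
  i = (n ∸ 29) % 108
  k = (n ∸ 29) / 108
  n≡ : 29 + i + 108 * k ≡ n
  n≡ = trans (trans (cong (λ v → 29 + i + v) (*-comm 108 k)) (+-assoc 29 i (k * 108)))
    (trans (cong (λ v → 29 + v) (sym (m≡m%n+[m/n]*n (n ∸ 29) 108))) (m+[n∸m]≡n n≥29))
  from-base : (∃ λ u → u < 2 × ∃ λ v → v < 4 ×
    let n = 29 + i; s = 5 * n / 27 ∸ u; c = n / 27 + v in Optimal n s (n ∸ (5 * s + c)) c) →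
    ∃ λ s → ∃ λ b → ∃ λ c → Optimal n s b c
  from-base (u , _ , v , _ , opt) =
    s + 20 * k , b + 4 * k , c + 4 * k ,
    subst (λ n → Optimal n (s + 20 * k) (b + 4 * k) (c + 4 * k)) n≡ (optimal-shift k opt)
    where
    s b c : ℕ
    s = 5 * (29 + i) / 27 ∸ u
    c = (29 + i) / 27 + v
    b = 29 + i ∸ (5 * s + c)

Attains : ℕ → ℤ → Set
Attains n m = Σ ℕ λ s → Σ ℕ λ t → (1 ≤ s) × (s ≤ t) × (t ≤ n) × (+ M4 n s t ≡ m)

optimal⇒attains : ∀ {n s b c} → Optimal n s b c → Attains n (bound (+ n))
optimal⇒attains {n} {s} {b} {c} (s≥1 , n≡ , c≤ , total≡) =
  s , t , s≥1 , m≤m+n s g , subst (t ≤_) t+c≡n (m≤m+n t c) , (begin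
    + M4 n s t
      ≡⟨ cong (λ n → + M4 n s t) t+c≡n ⟨
    + M4 (t + c) s t
      ≡⟨ cong +_ (M4-exact s g c (m≤m+n (4 * s) b) c≤ n≤) ⟩
    + (tri s + tri (g ∸ 4 * s) + tri c)
      ≡⟨ cong (λ v → + (tri s + tri v + tri c)) (m+n∸m≡n (4 * s) b) ⟩
    + (tri s + tri b + tri c)
      ≡⟨ total-tri s b c ⟨
    total (+ s) (+ b) (+ c)
      ≡⟨ total≡ ⟩
    bound (+ n) ∎)
  where
  open ≡-Reasoning
  g t : ℕ
  g = 4 * s + b
  t = s + g
  eq : ∀ s b c → s + (4 * s + b) + c ≡ 5 * s + b + c
  eq = solve-∀
  t+c≡n : t + c ≡ n
  t+c≡n = trans (eq s b c) n≡
  n≤ : t + c ≤ 4 * t + 4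
  n≤ = ≤-trans (+-monoʳ-≤ t c≤)
    (≤-trans (m≤m+n _ (11 * s + 3 * b)) (≤-reflexive (eq′ s b)))
    where
    eq′ : ∀ s b → s + (4 * s + b) + (4 * s + 4) + (11 * s + 3 * b) ≡ 4 * (s + (4 * s + b)) + 4
    eq′ = solve-∀

-- Small n and the conclusion

-- These colorings have no monochromatic triple. As s ≤ 4, sums from [s] exceed s and are either
-- blue or larger than n; blue sums are at least 5(s + 1) > t; and a red x or y above 24 gives a sum
-- above 28.
small-attained : ∀ {n} → n < 29 → 1 ≤ n →
  let s = 1 ⊔ n ⊓ 24 / 5; t = n ⊓ 24 in 1 ≤ s × s ≤ t × t ≤ n × + M4 n s t ≡ rhs4 n
small-attained = toWitness {a? = allUpTo? (λ n → 1 ≤? n →-dec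
  let s = 1 ⊔ n ⊓ 24 / 5; t = n ⊓ 24 in 1 ≤? s ×-dec s ≤? t ×-dec t ≤? n ×-dec + M4 n s t ℤ.≟ rhs4 n) 29} _

small-bound : ∀ {n} → n < 29 → 1 ≤ n → rhs4 n ≼ 0ℤ
small-bound = toWitness {a? = allUpTo? (λ n → 1 ≤? n →-dec rhs4 n ℤ.≤? 0ℤ) 29} _

-- Matching on the two equations turns `t` and `n` into the sums of block lengths for which
-- `bound-≤-M4` is stated.
rhs4-≤-M4 : ∀ {n s t} → 1 ≤ s → (∃ λ g → s + g ≡ t) → (∃ λ c → t + c ≡ n) → 29 ≤ n →
  rhs4 n ≼ + M4 n s t
rhs4-≤-M4 {s = s} s≥1 (g , refl) (c , refl) n≥29 = subst (_≼ + M4 (s + g + c) s (s + g))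
  (sym (rhs4≡bound (s + g + c))) (bound-≤-M4 s g c s≥1 n≥29)

theorem4 : (n : ℕ) → 1 ≤ n → IsM4min n (rhs4 n)
theorem4 n n≥1 = by-size (<-≤-connex n 29)
  where
  by-size : n < 29 ⊎ 29 ≤ n → IsM4min n (rhs4 n)
  by-size (inj₁ n<29) =
    (_ , _ , small-attained n<29 n≥1) , λ s t _ _ _ → ℤ.≤-trans (small-bound n<29 n≥1) nonNeg
  by-size (inj₂ n≥29) = attained (optimal-exists n n≥29) , lower
    where
    attained : (∃ λ s → ∃ λ b → ∃ λ c → Optimal n s b c) → Attains n (rhs4 n)
    attained (_ , _ , _ , opt) = subst (Attains n) (sym (rhs4≡bound n)) (optimal⇒attains opt)
    lower : ∀ s t → 1 ≤ s → s ≤ t → t ≤ n → rhs4 n ≼ + M4 n s t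
    lower s t s≥1 s≤t t≤n = rhs4-≤-M4 s≥1 (m≤n⇒∃[o]m+o≡n s≤t) (m≤n⇒∃[o]m+o≡n t≤n) n≥29
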